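{- There exists a constant $c_0>0$ such that for all $n,r,t\in\mathbb{N}$ and $\varepsilon\in(0,1)$ with $r<\frac{\varepsilon^2 n}{c_0 t}$, there is a 1-sided error, nonadaptive, $t$-online-erasure-resilient $\varepsilon$-tester for sortedness of $n$-element real sequences $f:[n]\to\mathbb{R}$ with at most $r$ distinct values, which makes $O(\sqrt r/\varepsilon)$ queries, each chosen uniformly and independently from $[n]$.
   Context: Online-erasure model. An input is a function $f:D\to R$ on a finite domain $D$. An algorithm accesses $f$ only through an oracle $\mathcal{O}$ by querying points $x\in D$ one at a time and receiving $\mathcal{O}(x)$. Initially $\mathcal{O}(x)=f(x)$ for all $x\in D$. For $t\in\mathbb{N}$, a $t$-online-erasure oracle, after answering each query, may choose up to $t$ points $x\in D$ and set $\mathcal{O}(x)=\perp$ (a special "erased" symbol); these values are used to answer all future queries. The choice of erasures (the adversarial strategy) may depend on $f$, on the queries and answers so far, and on the algorithm's code, but not on the algorithm's future random coins; the algorithm does not know where erasures are. A property $\mathcal{P}$ is a set of functions; $f$ is $\varepsilon$-far from $\mathcal{P}$ if for every $g\in\mathcal{P}$, $f$ and $g$ differ on at least an $\varepsilon$ fraction of $D$. A $t$-online-erasure-resilient $\varepsilon$-tester for $\mathcal{P}$ is a randomized algorithm that, given $t,\varepsilon$ and access to $f$ via a $t$-online-erasure oracle, for every adversarial strategy accepts with probability at least $2/3$ if $f\in\mathcal{P}$ and rejects with probability at least $2/3$ if $f$ is $\varepsilon$-far from $\mathcal{P}$. It has 1-sided error if it accepts every $f\in\mathcal{P}$ with probability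 1; it is nonadaptive if its queries do not depend on answers to previous queries. A sequence $f:[n]\to\mathbb{R}$ is sorted if $f(x)\le f(y)$ for all $x<y$; here the tester is promised that $f$ takes at most $r$ distinct values, and "$\varepsilon$-far" is with respect to the set of sorted sequences. -}

module Defs where

open import Data.Bool using (Bool; true; false; if_then_else_)
open import Data.Bool.Properties using () renaming (_≟_ to _≟ᵇ_)
open import Data.Fin using (Fin) renaming (_<_ to _<ᶠ_)
open import Data.Fin.Properties using (nonZeroIndex) renaming (_≟_ to _≟ᶠ_)
open import Data.Fin.Subset using (Subset; _∈_; _∪_; ∣_∣) renaming (⊥ to ∅)
open import Data.Fin.Subset.Properties using (_∈?_)
open import Data.Integer using (+_)
import Data.Integer as ℤ
import Data.Integer.Properties as ℤ
open import Data.Integer.Solver using () renaming (module +-*-Solver to ℤ-Solver)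
open import Data.Maybe using (Maybe; just; nothing)
import Data.Maybe.Relation.Binary.Pointwise as Maybe
open import Data.Nat using (ℕ; zero; suc)
import Data.Nat as ℕ
import Data.Nat.Properties as ℕ
open import Data.Product using (∃-syntax; Σ-syntax; _×_; _,_; proj₁; proj₂)
open import Data.Rational using (ℚ; mkℚ; 0ℚ; 1ℚ)
import Data.Rational as ℚ
import Data.Rational.Properties as ℚ
open import Data.Rational.Solver using (module +-*-Solver)
import Data.Rational.Unnormalised as ℚᵘ
import Data.Rational.Unnormalised.Properties as ℚᵘ
open import Data.Sum using (inj₁; inj₂)
open import Data.Vec using (Vec; []; _∷_; allFin; count; foldr′; lookup; map; reverse; tabulate)
open import Data.Vec.Properties using (≡-dec)
import Data.Vec.Relation.Binary.Pointwise.Inductive as Vec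
open import Level using (0ℓ)
open import Relation.Binary.PropositionalEquality using (_≡_; refl; sym; trans; cong; cong₂; subst; subst₂)
open import Relation.Nullary using (¬_; does; yes; no)
open import Relation.Unary using (Pred; Decidable)

-- Real numbers are Cauchy sequences of rationals, as a setoid under _≃_.

IsCauchy : (ℕ → ℚ) → Set
IsCauchy s = ∀ δ → 0ℚ ℚ.< δ →
  ∃[ N ] (∀ m n → N ℕ.≤ m → N ℕ.≤ n → ℚ.∣ s m ℚ.- s n ∣ ℚ.< δ)

record ℝ : Set where
  constructor mkℝ
  field
    seq    : ℕ → ℚ
    cauchy : IsCauchy seq

open ℝ public

infix 4 _<_ _≤_ _≃_
infixl 7 _*_

_<_ : ℝ → ℝ → Set
x < y = ∃[ δ ] (0ℚ ℚ.< δ × ∃[ N ] (∀ n → N ℕ.≤ n → seq x n ℚ.+ δ ℚ.≤ seq y n))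

_≤_ : ℝ → ℝ → Set
x ≤ y = ¬ (y < x)

_≃_ : ℝ → ℝ → Set
x ≃ y = x ≤ y × y ≤ x

fromℚ : ℚ → ℝ
fromℚ p = mkℝ (λ _ → p) λ δ 0<δ → 0 , λ _ _ _ _ →
  subst (λ z → ℚ.∣ z ∣ ℚ.< δ) (sym (ℚ.+-inverseʳ p)) 0<δ

fromℕ : ℕ → ℝ
fromℕ n = fromℚ (+ n ℚ./ 1)

private
  *-cauchy : ∀ {s u} → IsCauchy s → IsCauchy u → IsCauchy (λ n → s n ℚ.* u n)
  *-cauchy {s} {u} cs cu δ 0<δ = N , bound
    where
    0<1 : 0ℚ ℚ.< 1ℚ
    0<1 = ℚ.positive⁻¹ 1ℚ

    Ns = proj₁ (cs 1ℚ 0<1)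
    Nu = proj₁ (cu 1ℚ 0<1)

    B : ℚ
    B = 1ℚ ℚ.+ (ℚ.∣ s Ns ∣ ℚ.+ ℚ.∣ u Nu ∣)

    0<B : 0ℚ ℚ.< B
    0<B = ℚ.+-mono-<-≤ 0<1 (ℚ.+-mono-≤ (ℚ.0≤∣p∣ (s Ns)) (ℚ.0≤∣p∣ (u Nu)))

    instance
      B-pos : ℚ.Positive B
      B-pos = ℚ.positive 0<B
      B-nonNeg : ℚ.NonNegative B
      B-nonNeg = ℚ.pos⇒nonNeg B
      2B-pos : ℚ.Positive (B ℚ.+ B)
      2B-pos = ℚ.positive (ℚ.+-mono-< 0<B 0<B)
      2B-nonZero : ℚ.NonZero (B ℚ.+ B)
      2B-nonZero = ℚ.pos⇒nonZero (B ℚ.+ B)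
      δ-pos : ℚ.Positive δ
      δ-pos = ℚ.positive 0<δ

    δ′ : ℚ
    δ′ = δ ℚ.* ℚ.1/ (B ℚ.+ B)

    0<δ′ : 0ℚ ℚ.< δ′
    0<δ′ = ℚ.positive⁻¹ δ′ {{ℚ.pos*pos⇒pos δ (ℚ.1/ (B ℚ.+ B)) {{ℚ.1/pos⇒pos (B ℚ.+ B)}}}}

    Bδ′+δ′B≡δ : B ℚ.* δ′ ℚ.+ δ′ ℚ.* B ≡ δ
    Bδ′+δ′B≡δ = trans
      (solve 3 (λ b d i → b :* (d :* i) :+ (d :* i) :* b := d :* (i :* (b :+ b)))
        refl B δ (ℚ.1/ (B ℚ.+ B)))
      (trans (cong (δ ℚ.*_) (ℚ.*-inverseˡ (B ℚ.+ B))) (ℚ.*-identityʳ δ))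
      where open +-*-Solver

    Ms = proj₁ (cs δ′ 0<δ′)
    Mu = proj₁ (cu δ′ 0<δ′)

    N : ℕ
    N = (Ns ℕ.⊔ Nu) ℕ.⊔ (Ms ℕ.⊔ Mu)

    split : ∀ p q → ℚ.∣ p ℚ.- q ∣ ℚ.< 1ℚ → ℚ.∣ p ∣ ℚ.≤ 1ℚ ℚ.+ ℚ.∣ q ∣
    split p q lt = begin
      ℚ.∣ p ∣                      ≡⟨ cong ℚ.∣_∣ (solve 2 (λ a b → a := (a :- b) :+ b) refl p q) ⟩
      ℚ.∣ (p ℚ.- q) ℚ.+ q ∣        ≤⟨ ℚ.∣p+q∣≤∣p∣+∣q∣ (p ℚ.- q) q ⟩
      ℚ.∣ p ℚ.- q ∣ ℚ.+ ℚ.∣ q ∣    ≤⟨ ℚ.+-monoˡ-≤ ℚ.∣ q ∣ (ℚ.<⇒≤ lt) ⟩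
      1ℚ ℚ.+ ℚ.∣ q ∣               ∎
      where
      open ℚ.≤-Reasoning
      open +-*-Solver

    s≤B : ∀ m → Ns ℕ.≤ m → ℚ.∣ s m ∣ ℚ.≤ B
    s≤B m le = ℚ.≤-trans (split (s m) (s Ns) (proj₂ (cs 1ℚ 0<1) m Ns le ℕ.≤-refl))
      (ℚ.+-monoʳ-≤ 1ℚ (subst (ℚ._≤ ℚ.∣ s Ns ∣ ℚ.+ ℚ.∣ u Nu ∣) (ℚ.+-identityʳ ℚ.∣ s Ns ∣)
        (ℚ.+-monoʳ-≤ ℚ.∣ s Ns ∣ (ℚ.0≤∣p∣ (u Nu)))))

    u≤B : ∀ m → Nu ℕ.≤ m → ℚ.∣ u m ∣ ℚ.≤ B
    u≤B m le = ℚ.≤-trans (split (u m) (u Nu) (proj₂ (cu 1ℚ 0<1) m Nu le ℕ.≤-refl))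
      (ℚ.+-monoʳ-≤ 1ℚ (subst (ℚ._≤ ℚ.∣ s Ns ∣ ℚ.+ ℚ.∣ u Nu ∣) (ℚ.+-identityˡ ℚ.∣ u Nu ∣)
        (ℚ.+-monoˡ-≤ ℚ.∣ u Nu ∣ (ℚ.0≤∣p∣ (s Ns)))))

    bound : ∀ m n → N ℕ.≤ m → N ℕ.≤ n → ℚ.∣ s m ℚ.* u m ℚ.- s n ℚ.* u n ∣ ℚ.< δ
    bound m n N≤m N≤n = begin-strict
      ℚ.∣ s m ℚ.* u m ℚ.- s n ℚ.* u n ∣
        ≡⟨ cong ℚ.∣_∣ (solve 4 (λ a b c d → a :* b :- c :* d := a :* (b :- d) :+ (a :- c) :* d)
             refl (s m) (u m) (s n) (u n)) ⟩
      ℚ.∣ s m ℚ.* (u m ℚ.- u n) ℚ.+ (s m ℚ.- s n) ℚ.* u n ∣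
        ≤⟨ ℚ.∣p+q∣≤∣p∣+∣q∣ (s m ℚ.* (u m ℚ.- u n)) ((s m ℚ.- s n) ℚ.* u n) ⟩
      ℚ.∣ s m ℚ.* (u m ℚ.- u n) ∣ ℚ.+ ℚ.∣ (s m ℚ.- s n) ℚ.* u n ∣
        ≡⟨ cong₂ ℚ._+_ (ℚ.∣p*q∣≡∣p∣*∣q∣ (s m) (u m ℚ.- u n)) (ℚ.∣p*q∣≡∣p∣*∣q∣ (s m ℚ.- s n) (u n)) ⟩
      ℚ.∣ s m ∣ ℚ.* du ℚ.+ ds ℚ.* ℚ.∣ u n ∣
        ≤⟨ ℚ.+-mono-≤
             (ℚ.*-monoʳ-≤-nonNeg du {{ℚ.∣-∣-nonNeg (u m ℚ.- u n)}} (s≤B m (≤m Ns≤N)))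
             (ℚ.*-monoˡ-≤-nonNeg ds {{ℚ.∣-∣-nonNeg (s m ℚ.- s n)}} (u≤B n (≤n Nu≤N))) ⟩
      B ℚ.* du ℚ.+ ds ℚ.* B
        <⟨ ℚ.+-mono-<
             (ℚ.*-monoʳ-<-pos B (proj₂ (cu δ′ 0<δ′) m n (≤m Mu≤N) (≤n Mu≤N)))
             (ℚ.*-monoˡ-<-pos B (proj₂ (cs δ′ 0<δ′) m n (≤m Ms≤N) (≤n Ms≤N))) ⟩
      B ℚ.* δ′ ℚ.+ δ′ ℚ.* B
        ≡⟨ Bδ′+δ′B≡δ ⟩
      δ ∎
      where
      open ℚ.≤-Reasoning
      open +-*-Solver
      du = ℚ.∣ u m ℚ.- u n ∣
      ds = ℚ.∣ s m ℚ.- s n ∣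
      ≤m : ∀ {k} → k ℕ.≤ N → k ℕ.≤ m
      ≤m le = ℕ.≤-trans le N≤m
      ≤n : ∀ {k} → k ℕ.≤ N → k ℕ.≤ n
      ≤n le = ℕ.≤-trans le N≤n
      Ns≤N = ℕ.≤-trans (ℕ.m≤m⊔n Ns Nu) (ℕ.m≤m⊔n (Ns ℕ.⊔ Nu) (Ms ℕ.⊔ Mu))
      Nu≤N = ℕ.≤-trans (ℕ.m≤n⊔m Ns Nu) (ℕ.m≤m⊔n (Ns ℕ.⊔ Nu) (Ms ℕ.⊔ Mu))
      Ms≤N = ℕ.≤-trans (ℕ.m≤m⊔n Ms Mu) (ℕ.m≤n⊔m (Ns ℕ.⊔ Nu) (Ms ℕ.⊔ Mu))
      Mu≤N = ℕ.≤-trans (ℕ.m≤n⊔m Ms Mu) (ℕ.m≤n⊔m (Ns ℕ.⊔ Nu) (Ms ℕ.⊔ Mu))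

_*_ : ℝ → ℝ → ℝ
x * y = mkℝ (λ n → seq x n ℚ.* seq y n) (*-cauchy {seq x} {seq y} (cauchy x) (cauchy y))

⌊√_⌋ : ℕ → ℕ
⌊√ zero ⌋ = 0
⌊√ suc n ⌋ with suc ⌊√ n ⌋ ℕ.* suc ⌊√ n ⌋ ℕ.≤? suc n
... | yes _ = suc ⌊√ n ⌋
... | no  _ = ⌊√ n ⌋

⌊√n⌋²≤n : ∀ n → ⌊√ n ⌋ ℕ.* ⌊√ n ⌋ ℕ.≤ n
⌊√n⌋²≤n zero = ℕ.z≤n
⌊√n⌋²≤n (suc n) with suc ⌊√ n ⌋ ℕ.* suc ⌊√ n ⌋ ℕ.≤? suc n
... | yes le = le
... | no  _  = ℕ.m≤n⇒m≤1+n (⌊√n⌋²≤n n)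

n<[1+⌊√n⌋]² : ∀ n → n ℕ.< suc ⌊√ n ⌋ ℕ.* suc ⌊√ n ⌋
n<[1+⌊√n⌋]² zero = ℕ.s≤s ℕ.z≤n
n<[1+⌊√n⌋]² (suc n) with suc ⌊√ n ⌋ ℕ.* suc ⌊√ n ⌋ ℕ.≤? suc n
... | yes _  = ℕ.≤-<-trans (n<[1+⌊√n⌋]² n) (ℕ.*-mono-< (ℕ.n<1+n (suc ⌊√ n ⌋)) (ℕ.n<1+n (suc ⌊√ n ⌋)))
... | no ¬le = ℕ.≰⇒> ¬le

private
  √-seq : ℕ → ℕ → ℚ
  √-seq r k = + ⌊√ r ℕ.* (suc k ℕ.* suc k) ⌋ ℚ./ suc k

  /-mono : ∀ a m b k → a ℕ.* suc k ℕ.≤ b ℕ.* suc m → + a ℚ./ suc m ℚ.≤ + b ℚ./ suc k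
  /-mono a m b k le = ℚ.toℚᵘ-cancel-≤
    (ℚᵘ.≤-respˡ-≃ (ℚᵘ.≃-sym (ℚ.toℚᵘ-fromℚᵘ (ℚᵘ.mkℚᵘ (+ a) m)))
    (ℚᵘ.≤-respʳ-≃ (ℚᵘ.≃-sym (ℚ.toℚᵘ-fromℚᵘ (ℚᵘ.mkℚᵘ (+ b) k)))
    (ℚᵘ.*≤* (subst₂ ℤ._≤_ (ℤ.pos-* a (suc k)) (ℤ.pos-* b (suc m)) (ℤ.+≤+ le)))))

  /-suc : ∀ b k → + suc b ℚ./ suc k ≡ + b ℚ./ suc k ℚ.+ + 1 ℚ./ suc k
  /-suc b k = ℚ.toℚᵘ-injective (begin-equality
    ℚ.toℚᵘ (+ suc b ℚ./ suc k)
      ≃⟨ ℚ.toℚᵘ-fromℚᵘ (ℚᵘ.mkℚᵘ (+ suc b) k) ⟩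
    ℚᵘ.mkℚᵘ (+ suc b) k
      ≃⟨ ℚᵘ.*≡* (solve 2 (λ b d → (con (+ 1) :+ b) :* (d :* d) := (b :* d :+ con (+ 1) :* d) :* d)
           refl (+ b) (+ suc k)) ⟩
    ℚᵘ.mkℚᵘ (+ b) k ℚᵘ.+ ℚᵘ.mkℚᵘ (+ 1) k
      ≃⟨ ℚᵘ.+-cong (ℚ.toℚᵘ-fromℚᵘ (ℚᵘ.mkℚᵘ (+ b) k)) (ℚ.toℚᵘ-fromℚᵘ (ℚᵘ.mkℚᵘ (+ 1) k)) ⟨
    ℚ.toℚᵘ (+ b ℚ./ suc k) ℚᵘ.+ ℚ.toℚᵘ (+ 1 ℚ./ suc k)
      ≃⟨ ℚ.toℚᵘ-homo-+ (+ b ℚ./ suc k) (+ 1 ℚ./ suc k) ⟨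
    ℚ.toℚᵘ (+ b ℚ./ suc k ℚ.+ + 1 ℚ./ suc k) ∎)
    where
    open ℚᵘ.≤-Reasoning
    open ℤ-Solver

  1/<δ : ∀ δ → 0ℚ ℚ.< δ → ∀ k → ℚ.↧ₙ δ ℕ.≤ k → + 1 ℚ./ suc k ℚ.< δ
  1/<δ δ 0<δ k le with ℚ.positive 0<δ
  1/<δ (mkℚ (+ suc p) d c) 0<δ k le | _ = ℚ.toℚᵘ-cancel-<
    (ℚᵘ.<-respˡ-≃ (ℚᵘ.≃-sym (ℚ.toℚᵘ-fromℚᵘ (ℚᵘ.mkℚᵘ (+ 1) k)))
    (ℚᵘ.*<* (subst₂ ℤ._<_ (ℤ.pos-* 1 (suc d)) (ℤ.pos-* (suc p) (suc k)) (ℤ.+<+ lt))))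
    where
    lt : 1 ℕ.* suc d ℕ.< suc p ℕ.* suc k
    lt = ℕ.≤-trans (ℕ.s≤s (ℕ.≤-trans (ℕ.≤-reflexive (ℕ.*-identityˡ (suc d))) le))
                   (ℕ.m≤n*m (suc k) (suc p))

  √-seq-≤ : ∀ r m k → √-seq r m ℚ.≤ √-seq r k ℚ.+ + 1 ℚ./ suc k
  √-seq-≤ r m k = ℚ.≤-trans (/-mono a m (suc b) k (ℕ.≮⇒≥ λ lt → ℕ.<⇒≱ (squares lt) (ℕ.<⇒≤ chain)))
                            (ℚ.≤-reflexive (/-suc b k))
    where
    M = suc m
    K = suc k
    a = ⌊√ r ℕ.* (M ℕ.* M) ⌋
    b = ⌊√ r ℕ.* (K ℕ.* K) ⌋

    squares : suc b ℕ.* M ℕ.< a ℕ.* K → (suc b ℕ.* M) ℕ.* (suc b ℕ.* M) ℕ.< (a ℕ.* K) ℕ.* (a ℕ.* K)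
    squares lt = ℕ.*-mono-< lt lt

    chain : (a ℕ.* K) ℕ.* (a ℕ.* K) ℕ.< (suc b ℕ.* M) ℕ.* (suc b ℕ.* M)
    chain = begin-strict
      (a ℕ.* K) ℕ.* (a ℕ.* K)            ≡⟨ ℕ.[m*n]*[o*p]≡[m*o]*[n*p] a K a K ⟩
      (a ℕ.* a) ℕ.* (K ℕ.* K)            ≤⟨ ℕ.*-monoˡ-≤ (K ℕ.* K) (⌊√n⌋²≤n (r ℕ.* (M ℕ.* M))) ⟩
      (r ℕ.* (M ℕ.* M)) ℕ.* (K ℕ.* K)    ≡⟨ swap r (M ℕ.* M) (K ℕ.* K) ⟩
      (r ℕ.* (K ℕ.* K)) ℕ.* (M ℕ.* M)    <⟨ ℕ.*-monoˡ-< (M ℕ.* M) (n<[1+⌊√n⌋]² (r ℕ.* (K ℕ.* K))) ⟩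
      (suc b ℕ.* suc b) ℕ.* (M ℕ.* M)    ≡⟨ ℕ.[m*n]*[o*p]≡[m*o]*[n*p] (suc b) (suc b) M M ⟩
      (suc b ℕ.* M) ℕ.* (suc b ℕ.* M)    ∎
      where
      open ℕ.≤-Reasoning
      swap : ∀ x y z → (x ℕ.* y) ℕ.* z ≡ (x ℕ.* z) ℕ.* y
      swap x y z = trans (ℕ.*-assoc x y z) (trans (cong (x ℕ.*_) (ℕ.*-comm y z)) (sym (ℕ.*-assoc x z y)))

  √-cauchy : ∀ r → IsCauchy (√-seq r)
  √-cauchy r δ 0<δ = ℚ.↧ₙ δ , bound
    where
    half : ∀ m k → ℚ.↧ₙ δ ℕ.≤ k → √-seq r m ℚ.- √-seq r k ℚ.< δ
    half m k le = begin-strict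
      √-seq r m ℚ.- √-seq r k
        ≤⟨ ℚ.+-monoˡ-≤ (ℚ.- √-seq r k) (√-seq-≤ r m k) ⟩
      (√-seq r k ℚ.+ + 1 ℚ./ suc k) ℚ.- √-seq r k
        ≡⟨ solve 2 (λ x y → (x :+ y) :- x := y) refl (√-seq r k) (+ 1 ℚ./ suc k) ⟩
      + 1 ℚ./ suc k
        <⟨ 1/<δ δ 0<δ k le ⟩
      δ ∎
      where
      open ℚ.≤-Reasoning
      open +-*-Solver

    bound : ∀ m k → ℚ.↧ₙ δ ℕ.≤ m → ℚ.↧ₙ δ ℕ.≤ k → ℚ.∣ √-seq r m ℚ.- √-seq r k ∣ ℚ.< δ
    bound m k le₁ le₂ with ℚ.∣p∣≡p∨∣p∣≡-p (√-seq r m ℚ.- √-seq r k)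
    ... | inj₁ eq = subst (ℚ._< δ) (sym eq) (half m k le₂)
    ... | inj₂ eq = subst (ℚ._< δ) (sym (trans eq flip)) (half k m le₁)
      where
      open +-*-Solver
      flip = solve 2 (λ x y → :- (x :- y) := y :- x) refl (√-seq r m) (√-seq r k)

-- The k-th approximation is ⌊√ (r (k+1)²) ⌋ / (k+1).
√_ : ℕ → ℝ
√ r = mkℝ (√-seq r) (√-cauchy r)

-- Probability under the uniform distribution on Fin N.
Pr : ∀ {N} .{{_ : ℕ.NonZero N}} {P : Pred (Fin N) 0ℓ} → Decidable P → ℚ
Pr {N} P? = + count P? (allFin N) ℚ./ N

∏ : ∀ {k} → (Fin k → ℚ) → ℚ
∏ g = foldr′ ℚ._*_ 1ℚ (tabulate g)

-- nothing is the erasure symbol.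
Answer : Set
Answer = Maybe ℝ

_≃ᵃ_ : ∀ {i} → Vec Answer i → Vec Answer i → Set
_≃ᵃ_ = Vec.Pointwise (Maybe.Pointwise _≃_)

-- A randomized algorithm making q queries. Its coins are uniform on
-- Fin coins, and the answers it has received are listed most recent
-- first. (Its own past queries are determined by the coins and the
-- answers.) Only the values of query at answer vectors of length less
-- than q matter. The two congruence fields say that the algorithm sees
-- real numbers, not the Cauchy sequences representing them.
record Algorithm (n q : ℕ) : Set where
  field
    coins        : ℕ
    {{coins≢0}}  : ℕ.NonZero coins
    query        : Fin coins → ∀ {i} → Vec Answer i → Fin n
    accept       : Fin coins → Vec Answer q → Bool
    query-cong   : ∀ ω {i} {as bs : Vec Answer i} → as ≃ᵃ bs → query ω as ≡ query ω bs
    accept-cong  : ∀ ω {as bs : Vec Answer q} → as ≃ᵃ bs → accept ω as ≡ accept ω bs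

open Algorithm public

-- Query–answer pairs so far, most recent first.
History : ℕ → ℕ → Set
History n i = Vec (Fin n × Answer) i

-- erase h is the set erased just after the last query of h is answered.
-- Dependence on the input and on the algorithm comes from quantifying over
-- strategies after fixing both.
record Adversary (n t : ℕ) : Set where
  field
    erase  : ∀ {i} → History n i → Subset n
    budget : ∀ {i} (h : History n i) → ∣ erase h ∣ ℕ.≤ t

open Adversary public

module _ {n q t : ℕ} (A : Algorithm n q) (f : Fin n → ℝ) (S : Adversary n t) where

  oracle : Subset n → Fin n → Answer
  oracle E x = if does (x ∈? E) then nothing else just (f x)

  -- The history of the first i rounds and the set erased by then.
  run : Fin (coins A) → ∀ i → History n i × Subset n
  run ω zero    = [] , ∅
  run ω (suc i) =
    let h , E = run ω i
        x     = query A ω (map proj₂ h)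
        h′    = (x , oracle E x) ∷ h
    in h′ , E ∪ erase S h′

  output : Fin (coins A) → Bool
  output ω = accept A ω (map proj₂ (proj₁ (run ω q)))

  Pr[accept] : ℚ
  Pr[accept] = Pr λ ω → output ω ≟ᵇ true

  Pr[reject] : ℚ
  Pr[reject] = Pr λ ω → output ω ≟ᵇ false

  queries : Fin (coins A) → Vec (Fin n) q
  queries ω = reverse (map proj₁ (proj₁ (run ω q)))

Property : ℕ → Set₁
Property n = (Fin n → ℝ) → Set

-- The set of positions where f and g differ is not decidable without
-- classical logic, so a subset D of it with ∣ D ∣ ≥ ε n is asked for.
DifferOnFraction : ∀ {n} → ℝ → (f g : Fin n → ℝ) → Set
DifferOnFraction {n} ε f g =
  ∃[ D ] ((∀ x → x ∈ D → ¬ (f x ≃ g x)) × ε * fromℕ n ≤ fromℕ ∣ D ∣)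

Far : ∀ {n} → ℝ → Property n → Property n
Far ε P f = ∀ g → P g → DifferOnFraction ε f g

-- Q is the promise on the input.
IsResilientTester : ∀ {n q} (t : ℕ) (ε : ℝ) (Q P : Property n) → Algorithm n q → Set
IsResilientTester {n} t ε Q P A = ∀ f → Q f → (S : Adversary n t) →
  (P f → + 2 ℚ./ 3 ℚ.≤ Pr[accept] A f S) ×
  (Far ε P f → + 2 ℚ./ 3 ℚ.≤ Pr[reject] A f S)

HasOneSidedError : ∀ {n q} (t : ℕ) (Q P : Property n) → Algorithm n q → Set
HasOneSidedError {n} t Q P A = ∀ f → Q f → (S : Adversary n t) →
  P f → Pr[accept] A f S ≡ 1ℚ

Nonadaptive : ∀ {n q} → Algorithm n q → Set
Nonadaptive A = ∀ ω {i} (as bs : Vec Answer i) → query A ω as ≡ query A ω bs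

HasUniformQueries : ∀ {n q} (t : ℕ) → Algorithm n q → Set
HasUniformQueries {n} t A = ∀ f (S : Adversary n t) j x →
  Pr (λ ω → lookup (queries A f S ω) j ≟ᶠ x) ≡ (+ 1 ℚ./ n) {{nonZeroIndex x}}

HasIndependentQueries : ∀ {n q} (t : ℕ) → Algorithm n q → Set
HasIndependentQueries {n} t A = ∀ f (S : Adversary n t) z →
  Pr (λ ω → ≡-dec _≟ᶠ_ (queries A f S ω) z) ≡
  ∏ (λ j → Pr (λ ω → lookup (queries A f S ω) j ≟ᶠ lookup z j))

Sorted : ∀ {n} → Property n
Sorted f = ∀ x y → x <ᶠ y → f x ≤ f y

AtMostDistinctValues : ∀ {n} → ℕ → Property n
AtMostDistinctValues r f = Σ[ v ∈ (Fin r → ℝ) ] (∀ x → ∃[ i ] f x ≃ v i)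

{-# OPTIONS --safe #-}
module Submission where

-- A maximal matching of violating pairs (x < y, f x > f y) covers at least ε n
-- positions, because f can be made sorted by changing only the covered ones.
-- Group its m ≥ ε n / 2 edges by the value at the left endpoint. If x and x′ are
-- left endpoints in the same group and x ≤ x′, then x and the partner of x′ form
-- a violating pair; by Cauchy–Schwarz over the r groups there are at least
-- m² / 2r such good pairs, and no position lies in too many of them. A second
-- moment bound then shows that O(√r / ε) uniform samples contain a good pair with
-- high probability. The adversary erases at most q t points during q queries, so
-- some query is erased with probability at most q² t / n = O(r t / ε² n), which is
-- small by the assumption on r.

open import Defs hiding (_<_; _≤_; _*_)
open import Axiom.ExcludedMiddle using (ExcludedMiddle)
open import Data.Bool using (Bool; true; false; not; if_then_else_)
open import Data.Bool.Properties using () renaming (_≟_ to _≟ᵇ_)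
open import Data.Empty using (⊥-elim)
open import Data.Fin using (Fin; zero; suc; toℕ; fromℕ<; combine; remQuot; _↑ˡ_; _↑ʳ_) renaming (_<_ to _<ᶠ_; _≤_ to _≤ᶠ_)
open import Data.Fin.Permutation using (permutation)
open import Data.Fin.Properties using (nonZeroIndex; remQuot-combine; toℕ-injective; toℕ<n; toℕ-fromℕ<) renaming (_≟_ to _≟ᶠ_; _<?_ to _<ᶠ?_; _≤?_ to _≤ᶠ?_; ≤-total to ≤ᶠ-total; <-cmp to <ᶠ-cmp)
open import Data.Fin.Subset using (Subset; _∈_; _∉_; _∪_; ∣_∣; inside; outside) renaming (⊥ to ∅)
open import Data.Fin.Subset.Properties using (_∈?_; ∣⊥∣≡0; drop-there)
import Data.Integer as ℤ
import Data.Integer.Properties as ℤ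
open import Data.Maybe using (just; nothing)
import Data.Maybe.Relation.Binary.Pointwise as Maybe
open import Data.Nat using (ℕ; zero; suc)
import Data.Nat as ℕ
import Data.Nat.Properties as ℕ
open import Data.Nat.Tactic.RingSolver using (solve-∀)
open import Data.Product using (_×_; _,_; proj₁; proj₂; ∃-syntax; Σ-syntax)
open import Data.Rational using (ℚ; mkℚ; 0ℚ; 1ℚ)
import Data.Rational as ℚ
import Data.Rational.Properties as ℚ
open import Data.Rational.Solver using (module +-*-Solver)
import Data.Rational.Unnormalised as ℚᵘ
import Data.Rational.Unnormalised.Properties as ℚᵘ
open import Data.Sum using (_⊎_; inj₁; inj₂; [_,_]′)
open import Data.Vec using (Vec; []; _∷_; _++_; _∷ʳ_; lookup; map; reverse; count; tabulate)
import Data.Vec as Vec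
open import Data.Vec.Properties using (≡-dec; reverse-∷; ∷-injective)
import Data.Vec.Relation.Binary.Pointwise.Inductive as Vec
open import Function using (_∘_; id)
open import Level using (0ℓ)
open import Relation.Binary using (tri<; tri≈; tri>)
open import Relation.Binary.PropositionalEquality
open import Relation.Nullary using (¬_; Dec; yes; no; does; _×-dec_)
open import Relation.Nullary.Decidable using (dec-true)
open import Relation.Unary using (Pred; Decidable)

-- The obstacle in the second moment is the dependence between pairs that share a sample. The 2 s
-- samples are therefore split into two independent halves, the first searched for left endpoints
-- and the second for right endpoints. The number of good pairs found is then a bilinear sum, and
-- the second moment of a sum over one sample can be applied once per half. Pairs that share a
-- sample contribute through the degrees of the relation; a degree is at most the size of one value
-- group, whose square is at most twice the number of good pairs. With s = κ ρ k, where ρ² ≥ r and k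
-- replaces 1/ε, the expected number of good pairs is at least κ²/8. One is then found with
-- probability at least κ² / (κ² + 8 κ + 8), which is at least 5/6 from κ = 48 on; erasures cost at
-- most 1/6, leaving 2/3. Adaptivity of the adversary is harmless because each sample is independent
-- of the set erased before it. Probabilities are handled as counts of sample vectors in ℕ, with
-- denominators cleared. Excluded middle decides comparisons of input values, both in the verdict of
-- the tester and in the choice of the matching.

-- Order on the Cauchy reals and natural approximations of 1/ε.

module Real where

  open import Data.Integer using (+_)
  open Defs using (_<_; _≤_; _*_)

  p≤∣p∣ : ∀ p → p ℚ.≤ ℚ.∣ p ∣
  p≤∣p∣ p with ℚ.≤-total 0ℚ p
  ... | inj₁ 0≤p = ℚ.≤-reflexive (sym (ℚ.0≤p⇒∣p∣≡p 0≤p))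
  ... | inj₂ p≤0 = ℚ.≤-trans p≤0 (ℚ.0≤∣p∣ p)

  ∣p-q∣<η⇒p≤q+η : ∀ p q {η} → ℚ.∣ p ℚ.- q ∣ ℚ.< η → p ℚ.≤ q ℚ.+ η
  ∣p-q∣<η⇒p≤q+η p q {η} lt = begin
    p                    ≡⟨ solve 2 (λ a b → a := b :+ (a :- b)) refl p q ⟩
    q ℚ.+ (p ℚ.- q)      ≤⟨ ℚ.+-monoʳ-≤ q (ℚ.≤-trans (p≤∣p∣ (p ℚ.- q)) (ℚ.<⇒≤ lt)) ⟩
    q ℚ.+ η              ∎
    where
    open ℚ.≤-Reasoning
    open +-*-Solver

  p<p+δ : ∀ p {δ} → 0ℚ ℚ.< δ → p ℚ.< p ℚ.+ δ
  p<p+δ p {δ} 0<δ = subst (ℚ._< p ℚ.+ δ) (ℚ.+-identityʳ p) (ℚ.+-monoʳ-< p 0<δ)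

  <⇒≤ : ∀ x y → x < y → x ≤ y
  <⇒≤ x y (δ , 0<δ , N , h) (δ′ , 0<δ′ , N′ , h′) = ℚ.<-irrefl refl (begin-strict
    seq x m         <⟨ p<p+δ (seq x m) 0<δ ⟩
    seq x m ℚ.+ δ   ≤⟨ h m (ℕ.m≤m⊔n N N′) ⟩
    seq y m         <⟨ p<p+δ (seq y m) 0<δ′ ⟩
    seq y m ℚ.+ δ′  ≤⟨ h′ m (ℕ.m≤n⊔m N N′) ⟩
    seq x m         ∎)
    where
    open ℚ.≤-Reasoning
    m = N ℕ.⊔ N′

  ≤-refl : ∀ x → x ≤ x
  ≤-refl x x<x = <⇒≤ x x x<x x<x

  -- Past the Cauchy moduli of x and y for η = δ/8, compare y with x + δ/2.
  <-cotrans : ∀ x z → x < z → ∀ y → x < y ⊎ y < z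
  <-cotrans x z (δ , 0<δ , N , h) y = decide (ℚ.≤-total (seq x M ℚ.+ 4η) (seq y M))
    where
    open ℚ.≤-Reasoning
    open +-*-Solver
    ⅛ = + 1 ℚ./ 8
    η 2η 4η : ℚ
    η = ⅛ ℚ.* δ
    2η = η ℚ.+ η
    4η = 2η ℚ.+ 2η
    8η : 4η ℚ.+ 4η ≡ δ
    8η = solve 1 (λ d → let e = con ⅛ :* d ; 2e = e :+ e ; 4e = 2e :+ 2e in 4e :+ 4e := d) refl δ
    0<η : 0ℚ ℚ.< η
    0<η = subst (ℚ._< η) (ℚ.*-zeroʳ ⅛) (ℚ.*-monoʳ-<-pos ⅛ 0<δ)
    Nx = proj₁ (cauchy x η 0<η)
    Ny = proj₁ (cauchy y η 0<η)
    M = N ℕ.⊔ (Nx ℕ.⊔ Ny)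
    N≤M = ℕ.m≤m⊔n N (Nx ℕ.⊔ Ny)
    Nx≤M = ℕ.≤-trans (ℕ.m≤m⊔n Nx Ny) (ℕ.m≤n⊔m N (Nx ℕ.⊔ Ny))
    Ny≤M = ℕ.≤-trans (ℕ.m≤n⊔m Nx Ny) (ℕ.m≤n⊔m N (Nx ℕ.⊔ Ny))
    near : ∀ w {K} → (∀ i j → K ℕ.≤ i → K ℕ.≤ j → ℚ.∣ seq w i ℚ.- seq w j ∣ ℚ.< η) → K ℕ.≤ M →
           ∀ i j → M ℕ.≤ i → M ℕ.≤ j → seq w i ℚ.≤ seq w j ℚ.+ η
    near w c K≤M i j M≤i M≤j =
      ∣p-q∣<η⇒p≤q+η (seq w i) (seq w j) (c i j (ℕ.≤-trans K≤M M≤i) (ℕ.≤-trans K≤M M≤j))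
    near-x = near x (proj₂ (cauchy x η 0<η)) Nx≤M
    near-y = near y (proj₂ (cauchy y η 0<η)) Ny≤M
    decide : seq x M ℚ.+ 4η ℚ.≤ seq y M ⊎ seq y M ℚ.≤ seq x M ℚ.+ 4η → x < y ⊎ y < z
    decide (inj₁ le) = inj₁ (2η , ℚ.+-mono-< 0<η 0<η , M , λ m M≤m → begin
      seq x m ℚ.+ 2η                        ≤⟨ ℚ.+-monoˡ-≤ 2η (near-x m M M≤m ℕ.≤-refl) ⟩
      seq x M ℚ.+ η ℚ.+ 2η                  ≡⟨ solve 2 (λ a e → a :+ e :+ (e :+ e) := a :+ (e :+ e :+ (e :+ e)) :- e) refl (seq x M) η ⟩
      seq x M ℚ.+ 4η ℚ.- η                  ≤⟨ ℚ.+-monoˡ-≤ (ℚ.- η) (ℚ.≤-trans le (near-y M m ℕ.≤-refl M≤m)) ⟩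
      seq y m ℚ.+ η ℚ.- η                   ≡⟨ solve 2 (λ a e → a :+ e :- e := a) refl (seq y m) η ⟩
      seq y m                               ∎)
    decide (inj₂ le) = inj₂ (2η , ℚ.+-mono-< 0<η 0<η , M , λ m M≤m → begin
      seq y m ℚ.+ 2η                        ≤⟨ ℚ.+-monoˡ-≤ 2η (near-y m M M≤m ℕ.≤-refl) ⟩
      seq y M ℚ.+ η ℚ.+ 2η                  ≤⟨ ℚ.+-monoˡ-≤ 2η (ℚ.+-monoˡ-≤ η le) ⟩
      seq x M ℚ.+ 4η ℚ.+ η ℚ.+ 2η           ≤⟨ ℚ.+-monoˡ-≤ 2η (ℚ.+-monoˡ-≤ η (ℚ.+-monoˡ-≤ 4η (near-x M m ℕ.≤-refl M≤m))) ⟩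
      seq x m ℚ.+ η ℚ.+ 4η ℚ.+ η ℚ.+ 2η     ≡⟨ solve 2 (λ a e → let 4e = e :+ e :+ (e :+ e) in a :+ e :+ 4e :+ e :+ (e :+ e) := a :+ (4e :+ 4e)) refl (seq x m) η ⟩
      seq x m ℚ.+ (4η ℚ.+ 4η)               ≡⟨ cong (seq x m ℚ.+_) 8η ⟩
      seq x m ℚ.+ δ                         ≤⟨ h m (ℕ.≤-trans N≤M M≤m) ⟩
      seq z m                               ∎)

  ≤-trans : ∀ x y z → x ≤ y → y ≤ z → x ≤ z
  ≤-trans x y z x≤y y≤z z<x = [ y≤z , x≤y ]′ (<-cotrans z x z<x y)

  <-≤-trans : ∀ x y z → x < y → y ≤ z → x < z
  <-≤-trans x y z x<y y≤z = [ (λ x<z → x<z) , (λ z<y → ⊥-elim (y≤z z<y)) ]′ (<-cotrans x y x<y z)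

  ≤-<-trans : ∀ x y z → x ≤ y → y < z → x < z
  ≤-<-trans x y z x≤y y<z = [ (λ y<x → ⊥-elim (x≤y y<x)) , (λ x<z → x<z) ]′ (<-cotrans y z y<z x)

  -- Every term of the sequence representing `fromℕ a`, so that inequalities between reals unfold to
  -- inequalities between values of `ι`.
  ι : ℕ → ℚ
  ι a = + a ℚ./ 1

  toℚᵘ-/ : ∀ a b → ℚ.toℚᵘ (+ a ℚ./ suc b) ℚᵘ.≃ ℚᵘ.mkℚᵘ (+ a) b
  toℚᵘ-/ a b = ℚ.toℚᵘ-fromℚᵘ (ℚᵘ.mkℚᵘ (+ a) b)

  /-mono-≤ : ∀ a b c d .{{_ : ℕ.NonZero b}} .{{_ : ℕ.NonZero d}} →
             a ℕ.* d ℕ.≤ c ℕ.* b → + a ℚ./ b ℚ.≤ + c ℚ./ d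
  /-mono-≤ a (suc b) c (suc d) le = ℚ.toℚᵘ-cancel-≤
    (ℚᵘ.≤-respˡ-≃ (ℚᵘ.≃-sym (toℚᵘ-/ a b)) (ℚᵘ.≤-respʳ-≃ (ℚᵘ.≃-sym (toℚᵘ-/ c d))
    (ℚᵘ.*≤* (subst₂ ℤ._≤_ (ℤ.pos-* a (suc d)) (ℤ.pos-* c (suc b)) (ℤ.+≤+ le)))))

  /-cong : ∀ a b c d .{{_ : ℕ.NonZero b}} .{{_ : ℕ.NonZero d}} →
           a ℕ.* d ≡ c ℕ.* b → + a ℚ./ b ≡ + c ℚ./ d
  /-cong a b c d eq = ℚ.≤-antisym (/-mono-≤ a b c d (ℕ.≤-reflexive eq)) (/-mono-≤ c d a b (ℕ.≤-reflexive (sym eq)))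

  /-* : ∀ a b c d .{{_ : ℕ.NonZero b}} .{{_ : ℕ.NonZero d}} .{{_ : ℕ.NonZero (b ℕ.* d)}} →
        (+ a ℚ./ b) ℚ.* (+ c ℚ./ d) ≡ + (a ℕ.* c) ℚ./ (b ℕ.* d)
  /-* a (suc b) c (suc d) = ℚ.toℚᵘ-injective (begin-equality
    ℚ.toℚᵘ ((+ a ℚ./ suc b) ℚ.* (+ c ℚ./ suc d))
      ≃⟨ ℚ.toℚᵘ-homo-* (+ a ℚ./ suc b) (+ c ℚ./ suc d) ⟩
    ℚ.toℚᵘ (+ a ℚ./ suc b) ℚᵘ.* ℚ.toℚᵘ (+ c ℚ./ suc d)
      ≃⟨ ℚᵘ.*-cong (toℚᵘ-/ a b) (toℚᵘ-/ c d) ⟩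
    ℚᵘ.mkℚᵘ (+ a) b ℚᵘ.* ℚᵘ.mkℚᵘ (+ c) d
      ≡⟨ cong (λ z → ℚᵘ.mkℚᵘ z (d ℕ.+ b ℕ.* suc d)) (sym (ℤ.pos-* a c)) ⟩
    ℚᵘ.mkℚᵘ (+ (a ℕ.* c)) (d ℕ.+ b ℕ.* suc d)
      ≃⟨ toℚᵘ-/ (a ℕ.* c) (d ℕ.+ b ℕ.* suc d) ⟨
    ℚ.toℚᵘ (+ (a ℕ.* c) ℚ./ (suc b ℕ.* suc d)) ∎)
    where open ℚᵘ.≤-Reasoning

  ι-* : ∀ a b → ι (a ℕ.* b) ≡ ι a ℚ.* ι b
  ι-* a b = sym (/-* a 1 b 1)

  ι-+ : ∀ a b → ι (a ℕ.+ b) ≡ ι a ℚ.+ ι b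
  ι-+ a b = ℚ.toℚᵘ-injective (begin-equality
    ℚ.toℚᵘ (ι (a ℕ.+ b))                    ≃⟨ toℚᵘ-/ (a ℕ.+ b) 0 ⟩
    ℚᵘ.mkℚᵘ (+ (a ℕ.+ b)) 0                 ≡⟨ cong (λ z → ℚᵘ.mkℚᵘ z 0) (cong₂ ℤ._+_ (ℤ.*-identityʳ (+ a)) (ℤ.*-identityʳ (+ b))) ⟨
    ℚᵘ.mkℚᵘ (+ a) 0 ℚᵘ.+ ℚᵘ.mkℚᵘ (+ b) 0    ≃⟨ ℚᵘ.+-cong (toℚᵘ-/ a 0) (toℚᵘ-/ b 0) ⟨
    ℚ.toℚᵘ (ι a) ℚᵘ.+ ℚ.toℚᵘ (ι b)          ≃⟨ ℚ.toℚᵘ-homo-+ (ι a) (ι b) ⟨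
    ℚ.toℚᵘ (ι a ℚ.+ ι b)                    ∎)
    where open ℚᵘ.≤-Reasoning

  ι-mono-≤ : ∀ {a b} → a ℕ.≤ b → ι a ℚ.≤ ι b
  ι-mono-≤ {a} {b} le = /-mono-≤ a 1 b 1 (ℕ.*-monoˡ-≤ 1 le)

  ι-mono-< : ∀ {a b} → a ℕ.< b → ι a ℚ.< ι b
  ι-mono-< {a} {b} lt = ℚ.<-≤-trans (p<p+δ (ι a) {ι 1} (ℚ.positive⁻¹ 1ℚ))
    (subst (ℚ._≤ ι b) (trans (cong ι (ℕ.+-comm 1 a)) (ι-+ a 1)) (ι-mono-≤ lt))

  ι-cancel-≤ : ∀ {a b} → ι a ℚ.≤ ι b → a ℕ.≤ b
  ι-cancel-≤ le = ℕ.≮⇒≥ λ lt → ℚ.<-irrefl refl (ℚ.<-≤-trans (ι-mono-< lt) le)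

  ι-nonNeg : ∀ a → ℚ.NonNegative (ι a)
  ι-nonNeg a = ℚ.nonNegative (ι-mono-≤ {0} {a} ℕ.z≤n)

  -- The denominator of δ serves as `K`, because the numerator of a positive rational is at least 1.
  archimedean : ∀ δ → 0ℚ ℚ.< δ → ∃[ K ] 1ℚ ℚ.≤ ι K ℚ.* δ
  archimedean δ 0<δ with ℚ.positive 0<δ
  archimedean δ@(mkℚ (+ suc p) d c) 0<δ | _ = suc d , ℚ.≤-trans
    (/-mono-≤ 1 1 (suc d ℕ.* suc p) (1 ℕ.* suc d) (begin
      1 ℕ.* (1 ℕ.* suc d)       ≡⟨ trans (ℕ.*-identityˡ (1 ℕ.* suc d)) (ℕ.*-identityˡ (suc d)) ⟩
      suc d                     ≤⟨ ℕ.m≤m*n (suc d) (suc p) ⟩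
      suc d ℕ.* suc p           ≡⟨ ℕ.*-identityʳ (suc d ℕ.* suc p) ⟨
      suc d ℕ.* suc p ℕ.* 1     ∎))
    (ℚ.≤-reflexive (trans (sym (/-* (suc d) 1 (suc p) (suc d))) (cong (ι (suc d) ℚ.*_) (ℚ.fromℚᵘ-toℚᵘ δ))))
    where open ℕ.≤-Reasoning

  -- Here `k` plays the role of 1/ε up to a factor of 3. The bounds are put on the late terms of the
  -- sequence, so that later estimates are plain rational arithmetic at one large index.
  ApproximatelyInverse : ℕ → ℝ → Set
  ApproximatelyInverse k ε = ∃[ N ] (∀ m → N ℕ.≤ m →
    0ℚ ℚ.≤ seq ε m × 1ℚ ℚ.≤ ι k ℚ.* seq ε m × ι k ℚ.* seq ε m ℚ.≤ ι 3)

  -- The search descends from 2 K, where k ε > 1. By cotransitivity between 1 and 2, the predecessor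
  -- either still exceeds 1 after scaling and the descent goes on, or is below 2. In the second case
  -- adding one more ε < 1 stays below 3.
  scale : ∀ ε → fromℕ 0 < ε → ε < fromℕ 1 → ∃[ k ] ApproximatelyInverse k ε
  scale ε (δ , 0<δ , N , h) (δ₁ , 0<δ₁ , N₁ , h₁) = descend (2 ℕ.* K) large
    where
    open ℚ.≤-Reasoning
    K = proj₁ (archimedean δ 0<δ)
    ε≥0 : ∀ m → N ℕ.≤ m → 0ℚ ℚ.≤ seq ε m
    ε≥0 m N≤m = ℚ.≤-trans (ℚ.≤-trans (ℚ.<⇒≤ 0<δ) (ℚ.≤-reflexive (sym (ℚ.+-identityˡ δ)))) (h m N≤m)
    large : fromℕ 1 < fromℕ (2 ℕ.* K) * ε
    large = 1ℚ , ℚ.positive⁻¹ 1ℚ , N , λ m N≤m → begin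
      ι 2                           ≤⟨ ℚ.*-monoˡ-≤-nonNeg (ι 2) (proj₂ (archimedean δ 0<δ)) ⟩
      ι 2 ℚ.* (ι K ℚ.* δ)           ≡⟨ ℚ.*-assoc (ι 2) (ι K) δ ⟨
      ι 2 ℚ.* ι K ℚ.* δ             ≡⟨ cong (ℚ._* δ) (ι-* 2 K) ⟨
      ι (2 ℕ.* K) ℚ.* δ             ≤⟨ ℚ.*-monoˡ-≤-nonNeg (ι (2 ℕ.* K)) {{ι-nonNeg (2 ℕ.* K)}}
                                         (subst (ℚ._≤ seq ε m) (ℚ.+-identityˡ δ) (h m N≤m)) ⟩
      ι (2 ℕ.* K) ℚ.* seq ε m       ∎
    finish : ∀ k → fromℕ 1 < fromℕ (suc k) * ε → fromℕ k * ε < fromℕ 2 → ∃[ k ] ApproximatelyInverse k ε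
    finish k (δ₂ , 0<δ₂ , N₂ , h₂) (δ₃ , 0<δ₃ , N₃ , h₃) = suc k , N ℕ.⊔ N₁ ℕ.⊔ (N₂ ℕ.⊔ N₃) , λ m le →
      let le₀ = ℕ.≤-trans (ℕ.≤-trans (ℕ.m≤m⊔n N N₁) (ℕ.m≤m⊔n _ (N₂ ℕ.⊔ N₃))) le
          le₁ = ℕ.≤-trans (ℕ.≤-trans (ℕ.m≤n⊔m N N₁) (ℕ.m≤m⊔n _ (N₂ ℕ.⊔ N₃))) le
          le₂ = ℕ.≤-trans (ℕ.≤-trans (ℕ.m≤m⊔n N₂ N₃) (ℕ.m≤n⊔m (N ℕ.⊔ N₁) _)) le
          le₃ = ℕ.≤-trans (ℕ.≤-trans (ℕ.m≤n⊔m N₂ N₃) (ℕ.m≤n⊔m (N ℕ.⊔ N₁) _)) le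
          e = seq ε m
      in ε≥0 m le₀ , ℚ.≤-trans (ℚ.<⇒≤ (p<p+δ 1ℚ 0<δ₂)) (h₂ m le₂) , (begin
        ι (suc k) ℚ.* e              ≡⟨ cong (ℚ._* e) (ι-+ 1 k) ⟩
        (1ℚ ℚ.+ ι k) ℚ.* e           ≡⟨ ℚ.*-distribʳ-+ e 1ℚ (ι k) ⟩
        1ℚ ℚ.* e ℚ.+ ι k ℚ.* e       ≡⟨ cong (ℚ._+ ι k ℚ.* e) (ℚ.*-identityˡ e) ⟩
        e ℚ.+ ι k ℚ.* e              ≤⟨ ℚ.+-mono-≤ (ℚ.≤-trans (ℚ.<⇒≤ (p<p+δ e 0<δ₁)) (h₁ m le₁))
                                          (ℚ.≤-trans (ℚ.<⇒≤ (p<p+δ (ι k ℚ.* e) 0<δ₃)) (h₃ m le₃)) ⟩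
        ι 3                          ∎)
    1<2 : fromℕ 1 < fromℕ 2
    1<2 = 1ℚ , ℚ.positive⁻¹ 1ℚ , 0 , λ _ _ → ℚ.≤-refl
    descend : ∀ k → fromℕ 1 < fromℕ k * ε → ∃[ k ] ApproximatelyInverse k ε
    descend zero (δ′ , 0<δ′ , N′ , h′) = ⊥-elim (ℚ.<-irrefl refl (begin-strict
      1ℚ                     <⟨ p<p+δ 1ℚ 0<δ′ ⟩
      1ℚ ℚ.+ δ′              ≤⟨ h′ N′ ℕ.≤-refl ⟩
      0ℚ ℚ.* seq ε N′        ≡⟨ ℚ.*-zeroˡ (seq ε N′) ⟩
      0ℚ                     <⟨ ℚ.positive⁻¹ 1ℚ ⟩
      1ℚ                     ∎))
    descend (suc k) big = [ descend k , finish k big ]′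
      (<-cotrans (fromℕ 1) (fromℕ 2) 1<2 (fromℕ k * ε))

-- Finite sums, Cauchy-Schwarz, and moments of sums over uniform samples.

module Sampling where

  import Algebra.Properties.Semiring.Sum
  open import Data.Nat
  open import Data.Nat.Properties
  module Sum = Algebra.Properties.Semiring.Sum +-*-semiring

  infix 8 _²
  _² : ℕ → ℕ
  x ² = x * x

  ²-cancel-≤ : ∀ {x y} → x ² ≤ y ² → x ≤ y
  ²-cancel-≤ le = ≮⇒≥ λ lt → <⇒≱ (*-mono-< lt lt) le

  2xy≤x²+y² : ∀ x y → 2 * (x * y) ≤ x ² + y ²
  2xy≤x²+y² x y with ≤-total x y
  ... | inj₁ x≤y = subst (λ z → 2 * (x * z) ≤ x ² + z ²) (m+[n∸m]≡n x≤y) (ordered x (y ∸ x))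
    where
    identity : ∀ a d → a * a + (a + d) * (a + d) ≡ 2 * (a * (a + d)) + d * d
    identity = solve-∀
    ordered : ∀ a d → 2 * (a * (a + d)) ≤ a ² + (a + d) ²
    ordered a d = ≤-trans (m≤m+n _ (d * d)) (≤-reflexive (sym (identity a d)))
  ... | inj₂ y≤x = subst (λ z → 2 * (z * y) ≤ z ² + y ²) (m+[n∸m]≡n y≤x) (ordered y (x ∸ y))
    where
    identity : ∀ a d → (a + d) * (a + d) + a * a ≡ 2 * ((a + d) * a) + d * d
    identity = solve-∀
    ordered : ∀ a d → 2 * ((a + d) * a) ≤ (a + d) ² + a ²
    ordered a d = ≤-trans (m≤m+n _ (d * d)) (≤-reflexive (sym (identity a d)))

  𝟙 : ∀ {p} {P : Set p} → Dec P → ℕ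
  𝟙 P? = if does P? then 1 else 0

  module _ {p} {P : Set p} where

    𝟙-yes : (P? : Dec P) → P → 𝟙 P? ≡ 1
    𝟙-yes (yes _) _ = refl
    𝟙-yes (no ¬p) p = ⊥-elim (¬p p)

    𝟙-no : (P? : Dec P) → ¬ P → 𝟙 P? ≡ 0
    𝟙-no (yes p) ¬p = ⊥-elim (¬p p)
    𝟙-no (no _) _ = refl

    𝟙-idem : (P? : Dec P) → 𝟙 P? ² ≡ 𝟙 P?
    𝟙-idem (yes _) = refl
    𝟙-idem (no _)  = refl

    𝟙-pos : (P? : Dec P) → 0 < 𝟙 P? → P
    𝟙-pos (yes p) _ = p

    𝟙-bound : (P? : Dec P) {x : ℕ} → (P → 1 ≤ x) → 𝟙 P? ≤ x
    𝟙-bound (yes p) h = h p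
    𝟙-bound (no _)  h = z≤n

  module _ {p q} {P : Set p} {Q : Set q} where

    𝟙-cong : (P? : Dec P) (Q? : Dec Q) → (P → Q) → (Q → P) → 𝟙 P? ≡ 𝟙 Q?
    𝟙-cong (yes p) Q? to from = sym (𝟙-yes Q? (to p))
    𝟙-cong (no ¬p) Q? to from = sym (𝟙-no Q? (¬p ∘ from))

    𝟙-×-≤ : ∀ {r} {R : Set r} (P? : Dec P) (Q? : Dec Q) (R? : Dec R) →
            (P → Q → R) → 𝟙 P? * 𝟙 Q? ≤ 𝟙 R?
    𝟙-×-≤ (no _)  Q?      R? h = z≤n
    𝟙-×-≤ (yes _) (no _)  R? h = z≤n
    𝟙-×-≤ (yes p) (yes q) R? h = ≤-reflexive (sym (𝟙-yes R? (h p q)))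

    𝟙-× : ∀ {r} {R : Set r} (P? : Dec P) (Q? : Dec Q) (R? : Dec R) →
          (P → Q → R) → (R → P × Q) → 𝟙 P? * 𝟙 Q? ≡ 𝟙 R?
    𝟙-× (no ¬p) Q?      R? h g = sym (𝟙-no R? (¬p ∘ proj₁ ∘ g))
    𝟙-× (yes _) (no ¬q) R? h g = sym (𝟙-no R? (¬q ∘ proj₂ ∘ g))
    𝟙-× (yes p) (yes q) R? h g = sym (𝟙-yes R? (h p q))

  -- Opaque so that the summand can be inferred by unification.
  opaque

    ∑ : ∀ {n} → (Fin n → ℕ) → ℕ
    ∑ = Sum.sum

    ∑-zero : (f : Fin 0 → ℕ) → ∑ f ≡ 0
    ∑-zero f = refl

    ∑-suc : ∀ {n} (f : Fin (suc n) → ℕ) → ∑ f ≡ f zero + ∑ (f ∘ suc)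
    ∑-suc f = refl

    ∑-cong : ∀ {n} {f g : Fin n → ℕ} → (∀ i → f i ≡ g i) → ∑ f ≡ ∑ g
    ∑-cong = Sum.sum-cong-≗

    ∑-mono : ∀ {n} {f g : Fin n → ℕ} → (∀ i → f i ≤ g i) → ∑ f ≤ ∑ g
    ∑-mono {zero}  le = z≤n
    ∑-mono {suc n} le = +-mono-≤ (le zero) (∑-mono (le ∘ suc))

    ∑-const : ∀ n c → ∑ {n} (λ _ → c) ≡ n * c
    ∑-const zero    c = refl
    ∑-const (suc n) c = cong (c +_) (∑-const n c)

    ∑-+ : ∀ {n} (f g : Fin n → ℕ) → ∑ (λ i → f i + g i) ≡ ∑ f + ∑ g
    ∑-+ = Sum.∑-distrib-+

    ∑-comm : ∀ {m n} (f : Fin m → Fin n → ℕ) → ∑ (λ i → ∑ λ j → f i j) ≡ ∑ (λ j → ∑ λ i → f i j)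
    ∑-comm = Sum.∑-comm

    *-∑ : ∀ {n} c (f : Fin n → ℕ) → ∑ (λ i → c * f i) ≡ c * ∑ f
    *-∑ c f = sym (Sum.*-distribˡ-sum c f)

    ∑-* : ∀ {n} (f : Fin n → ℕ) c → ∑ (λ i → f i * c) ≡ ∑ f * c
    ∑-* f c = sym (Sum.*-distribʳ-sum c f)

    ∑-involution : ∀ {n} {p : Fin n → Fin n} → (∀ x → p (p x) ≡ x) → ∀ f → ∑ (f ∘ p) ≡ ∑ f
    ∑-involution {p = p} inv f = sym (Sum.∑-permute f (permutation p p inv inv))

  ∑-0 : ∀ n → ∑ {n} (λ _ → 0) ≡ 0
  ∑-0 n = trans (∑-const n 0) (*-zeroʳ n)

  ∑-bound : ∀ {n} {f : Fin n → ℕ} c → (∀ i → f i ≤ c) → ∑ f ≤ n * c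
  ∑-bound {n} c le = ≤-trans (∑-mono le) (≤-reflexive (∑-const n c))

  ∑-𝟙 : ∀ {n} (j : Fin n) → ∑ (λ i → 𝟙 (i ≟ᶠ j)) ≡ 1
  ∑-𝟙 {suc n} zero    = trans (∑-suc _) (cong suc (trans (∑-cong λ i → 𝟙-no (suc i ≟ᶠ zero) λ ()) (∑-0 n)))
  ∑-𝟙 {suc n} (suc j) = trans (∑-suc _) (trans
    (∑-cong λ i → 𝟙-cong (suc i ≟ᶠ suc j) (i ≟ᶠ j) (λ { refl → refl }) (cong suc))
    (∑-𝟙 j))

  ∑*∑ : ∀ {m n} (f : Fin m → ℕ) (g : Fin n → ℕ) → ∑ f * ∑ g ≡ ∑ λ i → ∑ λ j → f i * g j
  ∑*∑ f g = trans (sym (∑-* f (∑ g))) (∑-cong λ i → sym (*-∑ (f i) g))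

  ∑-↑ : ∀ m {n} (f : Fin (m + n) → ℕ) → ∑ f ≡ ∑ (λ i → f (i ↑ˡ n)) + ∑ (λ j → f (m ↑ʳ j))
  ∑-↑ zero    f = cong (_+ ∑ f) (sym (∑-zero _))
  ∑-↑ (suc m) {n} f = begin
    ∑ f                                                               ≡⟨ ∑-suc f ⟩
    f zero + ∑ (f ∘ suc)                                              ≡⟨ cong (f zero +_) (∑-↑ m (f ∘ suc)) ⟩
    f zero + (∑ (λ i → f (suc (i ↑ˡ n))) + ∑ (λ j → f (suc (m ↑ʳ j)))) ≡⟨ +-assoc (f zero) _ _ ⟨
    f zero + ∑ (λ i → f (suc (i ↑ˡ n))) + ∑ (λ j → f (suc (m ↑ʳ j)))   ≡⟨ cong (_+ ∑ (λ j → f (suc (m ↑ʳ j)))) (∑-suc _) ⟨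
    ∑ (λ i → f (i ↑ˡ n)) + ∑ (λ j → f (suc m ↑ʳ j))                   ∎
    where open ≡-Reasoning

  ∑-combine : ∀ m n (f : Fin (m * n) → ℕ) → ∑ f ≡ ∑ λ (i : Fin m) → ∑ λ (j : Fin n) → f (combine i j)
  ∑-combine zero    n f = trans (∑-zero f) (sym (∑-zero _))
  ∑-combine (suc m) n f = trans (∑-↑ n f) (trans
    (cong (∑ (λ j → f (j ↑ˡ (m * n))) +_) (∑-combine m n (f ∘ (n ↑ʳ_)))) (sym (∑-suc _)))

  -- The hypothesis is pointwise so that the inequality iterates over nested sums.
  cauchySchwarz : ∀ {n} (x a b : Fin n → ℕ) → (∀ i → x i ² ≤ a i * b i) → ∑ x ² ≤ ∑ a * ∑ b
  cauchySchwarz {zero}  x a b le = subst (λ z → z ² ≤ ∑ a * ∑ b) (sym (∑-zero x)) z≤n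
  cauchySchwarz {suc n} x a b le = begin
    ∑ x ²                               ≡⟨ cong _² (∑-suc x) ⟩
    (x₀ + X) ²                          ≡⟨ expand x₀ X ⟩
    x₀ ² + 2 * (x₀ * X) + X ²           ≤⟨ +-mono-≤ (+-mono-≤ (le zero) cross) IH ⟩
    a₀ * b₀ + (a₀ * B + A * b₀) + A * B ≡⟨ collect a₀ b₀ A B ⟩
    (a₀ + A) * (b₀ + B)                 ≡⟨ cong₂ _*_ (∑-suc a) (∑-suc b) ⟨
    ∑ a * ∑ b                           ∎
    where
    open ≤-Reasoning
    x₀ = x zero
    a₀ = a zero
    b₀ = b zero
    X = ∑ (x ∘ suc)
    A = ∑ (a ∘ suc)
    B = ∑ (b ∘ suc)
    IH : X ² ≤ A * B
    IH = cauchySchwarz (x ∘ suc) (a ∘ suc) (b ∘ suc) (le ∘ suc)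
    expand : ∀ u v → (u + v) * (u + v) ≡ u * u + 2 * (u * v) + v * v
    expand = solve-∀
    collect : ∀ a b c d → a * b + (a * d + c * b) + c * d ≡ (a + c) * (b + d)
    collect = solve-∀
    square : ∀ u v → (2 * (u * v)) * (2 * (u * v)) ≡ 4 * ((u * u) * (v * v))
    square = solve-∀
    regroup : ∀ a b c d → 4 * ((a * b) * (c * d)) ≡ 2 * ((a * d) * (c * b)) + 2 * ((a * d) * (c * b))
    regroup = solve-∀
    regroup′ : ∀ u v → (u * u + v * v) + 2 * (u * v) ≡ (u + v) * (u + v)
    regroup′ = solve-∀
    -- Comparing squares avoids square roots: (x₀ X)² is at most (a₀ b₀)(A B) = (a₀ B)(A b₀), and
    -- the arithmetic-geometric mean inequality applies to `a₀ * B` and `A * b₀`.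
    cross : 2 * (x₀ * X) ≤ a₀ * B + A * b₀
    cross = ²-cancel-≤ (begin
      (2 * (x₀ * X)) ²                                     ≡⟨ square x₀ X ⟩
      4 * (x₀ ² * X ²)                                     ≤⟨ *-monoʳ-≤ 4 (*-mono-≤ (le zero) IH) ⟩
      4 * ((a₀ * b₀) * (A * B))                            ≡⟨ regroup a₀ b₀ A B ⟩
      2 * ((a₀ * B) * (A * b₀)) + 2 * ((a₀ * B) * (A * b₀)) ≤⟨ +-monoˡ-≤ _ (2xy≤x²+y² (a₀ * B) (A * b₀)) ⟩
      ((a₀ * B) ² + (A * b₀) ²) + 2 * ((a₀ * B) * (A * b₀)) ≡⟨ regroup′ (a₀ * B) (A * b₀) ⟩
      (a₀ * B + A * b₀) ²                                  ∎)

  -- This is n ^ s times the expectation of `F` under s independent uniform samples.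
  𝕊 : ∀ {n} s → (Vec (Fin n) s → ℕ) → ℕ
  𝕊 zero    F = F []
  𝕊 (suc s) F = ∑ λ x → 𝕊 s λ v → F (x ∷ v)

  module _ {n : ℕ} where

    𝕊-cong : ∀ s {F G : Vec (Fin n) s → ℕ} → (∀ v → F v ≡ G v) → 𝕊 s F ≡ 𝕊 s G
    𝕊-cong zero    eq = eq []
    𝕊-cong (suc s) eq = ∑-cong λ x → 𝕊-cong s λ v → eq (x ∷ v)

    𝕊-mono : ∀ s {F G : Vec (Fin n) s → ℕ} → (∀ v → F v ≤ G v) → 𝕊 s F ≤ 𝕊 s G
    𝕊-mono zero    le = le []
    𝕊-mono (suc s) le = ∑-mono λ x → 𝕊-mono s λ v → le (x ∷ v)

    𝕊-+ : ∀ s (F G : Vec (Fin n) s → ℕ) → 𝕊 s (λ v → F v + G v) ≡ 𝕊 s F + 𝕊 s G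
    𝕊-+ zero    F G = refl
    𝕊-+ (suc s) F G = trans (∑-cong λ x → 𝕊-+ s (F ∘ (x ∷_)) (G ∘ (x ∷_))) (∑-+ _ _)

    𝕊-* : ∀ s c (F : Vec (Fin n) s → ℕ) → 𝕊 s (λ v → c * F v) ≡ c * 𝕊 s F
    𝕊-* zero    c F = refl
    𝕊-* (suc s) c F = trans (∑-cong λ x → 𝕊-* s c (F ∘ (x ∷_))) (*-∑ c (λ x → 𝕊 s (F ∘ (x ∷_))))

    𝕊-const : ∀ s c → 𝕊 {n} s (λ _ → c) ≡ n ^ s * c
    𝕊-const zero    c = sym (+-identityʳ c)
    𝕊-const (suc s) c = trans (trans (∑-cong λ _ → 𝕊-const s c) (∑-const n (n ^ s * c))) (sym (*-assoc n (n ^ s) c))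

    𝕊-∑ : ∀ s {m} (F : Vec (Fin n) s → Fin m → ℕ) →
          𝕊 s (λ v → ∑ (λ y → F v y)) ≡ ∑ (λ y → 𝕊 s λ v → F v y)
    𝕊-∑ zero    F = refl
    𝕊-∑ (suc s) F = trans (∑-cong λ x → 𝕊-∑ s (F ∘ (x ∷_))) (∑-comm λ x y → 𝕊 s λ v → F (x ∷ v) y)

    𝕊-++ : ∀ s t (F : Vec (Fin n) (s + t) → ℕ) → 𝕊 (s + t) F ≡ 𝕊 s λ u → 𝕊 t λ v → F (u ++ v)
    𝕊-++ zero    t F = refl
    𝕊-++ (suc s) t F = ∑-cong λ x → 𝕊-++ s t (F ∘ (x ∷_))

    𝕊-cauchySchwarz : ∀ s (X A B : Vec (Fin n) s → ℕ) → (∀ v → X v ² ≤ A v * B v) → 𝕊 s X ² ≤ 𝕊 s A * 𝕊 s B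
    𝕊-cauchySchwarz zero    X A B le = le []
    𝕊-cauchySchwarz (suc s) X A B le = cauchySchwarz _ _ _ λ x →
      𝕊-cauchySchwarz s (X ∘ (x ∷_)) (A ∘ (x ∷_)) (B ∘ (x ∷_)) (le ∘ (x ∷_))

    -- The coins are read as s digits in base n, which makes uniform coins the same as s independent
    -- uniform samples.
    decode : ∀ s → Fin (n ^ s) → Vec (Fin n) s
    decode zero    ω = []
    decode (suc s) ω = proj₁ (remQuot {n} (n ^ s) ω) ∷ decode s (proj₂ (remQuot {n} (n ^ s) ω))

    ∑-decode : ∀ s (F : Vec (Fin n) s → ℕ) → ∑ (F ∘ decode s) ≡ 𝕊 s F
    ∑-decode zero    F = trans (∑-suc _) (trans (cong (F [] +_) (∑-zero _)) (+-identityʳ (F [])))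
    ∑-decode (suc s) F = trans (∑-combine n (n ^ s) (F ∘ decode (suc s))) (∑-cong λ x →
      trans (∑-cong λ j → cong (λ z → F (proj₁ z ∷ decode s (proj₂ z))) (remQuot-combine x j))
            (∑-decode s (F ∘ (x ∷_))))

    𝕊-lookup : ∀ s (j : Fin s) (x : Fin n) → n * 𝕊 s (λ v → 𝟙 (lookup v j ≟ᶠ x)) ≡ n ^ s
    𝕊-lookup (suc s) zero    x = cong (n *_) (begin
      ∑ (λ y → 𝕊 s λ _ → 𝟙 (y ≟ᶠ x))  ≡⟨ ∑-cong (λ y → 𝕊-const s (𝟙 (y ≟ᶠ x))) ⟩
      ∑ (λ y → n ^ s * 𝟙 (y ≟ᶠ x))    ≡⟨ *-∑ (n ^ s) (λ y → 𝟙 (y ≟ᶠ x)) ⟩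
      n ^ s * ∑ (λ y → 𝟙 (y ≟ᶠ x))      ≡⟨ cong (n ^ s *_) (∑-𝟙 x) ⟩
      n ^ s * 1                          ≡⟨ *-identityʳ (n ^ s) ⟩
      n ^ s                              ∎)
      where open ≡-Reasoning
    𝕊-lookup (suc s) (suc j) x = cong (n *_) (trans (∑-const n _) (𝕊-lookup s j x))

  Σᵛ : ∀ {n s} → (Fin n → ℕ) → Vec (Fin n) s → ℕ
  Σᵛ g []      = 0
  Σᵛ g (x ∷ v) = g x + Σᵛ g v

  module _ {n : ℕ} where

    Σᵛ-∑ : ∀ {s m} (F : Fin n → Fin m → ℕ) (v : Vec (Fin n) s) →
           ∑ (λ y → Σᵛ (λ x → F x y) v) ≡ Σᵛ (λ x → ∑ (λ y → F x y)) v
    Σᵛ-∑ {m = m} F []      = ∑-0 m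
    Σᵛ-∑ {m = m} F (x ∷ v) = trans (∑-+ _ _) (cong (∑ (λ y → F x y) +_) (Σᵛ-∑ F v))

    firstMoment : ∀ s (g : Fin n → ℕ) → n * 𝕊 s (Σᵛ g) ≡ n ^ s * (s * ∑ g)
    firstMoment zero    g = *-zeroʳ n
    firstMoment (suc s) g = begin
      n * ∑ (λ x → 𝕊 s λ v → g x + Σᵛ g v)
        ≡⟨ cong (n *_) (∑-cong λ x → trans (𝕊-+ s (λ _ → g x) (Σᵛ g)) (cong (_+ 𝕊 s (Σᵛ g)) (𝕊-const s (g x)))) ⟩
      n * ∑ (λ x → n ^ s * g x + 𝕊 s (Σᵛ g))
        ≡⟨ cong (n *_) (trans (∑-+ _ _) (cong₂ _+_ (*-∑ (n ^ s) g) (∑-const n _))) ⟩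
      n * (n ^ s * ∑ g + n * 𝕊 s (Σᵛ g))
        ≡⟨ cong (λ z → n * (n ^ s * ∑ g + z)) (firstMoment s g) ⟩
      n * (n ^ s * ∑ g + n ^ s * (s * ∑ g))
        ≡⟨ collect n (n ^ s) s (∑ g) ⟩
      n * n ^ s * (suc s * ∑ g) ∎
      where
      open ≡-Reasoning
      collect : ∀ n N s g → n * (N * g + N * (s * g)) ≡ n * N * ((1 + s) * g)
      collect = solve-∀

    -- Expanding the square of the sum, equal indices contribute s ∑g² / n to the expectation and
    -- distinct ones s (s - 1) (∑g)² / n². The factor s (s - 1) is rounded up to s²; in the
    -- induction this is the slack that turns s² + 2 s into (1 + s)².
    secondMoment : ∀ s (g : Fin n → ℕ) →
      n ² * 𝕊 s (λ v → Σᵛ g v ²) ≤ n ^ s * (s * n * ∑ (λ x → g x ²) + s ² * ∑ g ²)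
    secondMoment zero    g = ≤-reflexive (*-zeroʳ (n ²))
    secondMoment (suc s) g = begin
      n ² * ∑ (λ x → 𝕊 s λ v → (g x + Σᵛ g v) ²)
        ≡⟨ cong (n ² *_) (trans (∑-cong inner) (trans (∑-+ _ _) (cong₂ _+_
             (trans (∑-+ _ _) (cong₂ _+_ (*-∑ N (λ x → g x ²))
               (∑-* g (2 * M₁)))) (∑-const n M₂)))) ⟩
      n ² * (N * G₂ + G * (2 * M₁) + n * M₂)
        ≡⟨ rearrange n N G G₂ M₁ M₂ ⟩
      N * (n ² * G₂) + 2 * n * G * (n * M₁) + n * (n ² * M₂)
        ≤⟨ +-mono-≤ (≤-reflexive (cong (λ z → N * (n ² * G₂) + 2 * n * G * z) (firstMoment s g)))
             (*-monoʳ-≤ n (secondMoment s g)) ⟩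
      N * (n ² * G₂) + 2 * n * G * (N * (s * G)) + n * (N * (s * n * G₂ + s ² * G ²))
        ≤⟨ m≤m+n _ (n * N * G ²) ⟩
      N * (n ² * G₂) + 2 * n * G * (N * (s * G)) + n * (N * (s * n * G₂ + s ² * G ²)) + n * N * G ²
        ≡⟨ collect n N s G G₂ ⟩
      n * N * (suc s * n * G₂ + suc s ² * G ²) ∎
      where
      open ≤-Reasoning
      N = n ^ s
      G = ∑ g
      G₂ = ∑ (λ x → g x ²)
      M₁ = 𝕊 s (Σᵛ g)
      M₂ = 𝕊 s (λ v → Σᵛ g v ²)
      expand : ∀ a b → (a + b) * (a + b) ≡ a * a + 2 * a * b + b * b
      expand = solve-∀
      swap : ∀ a m → 2 * a * m ≡ a * (2 * m)
      swap = solve-∀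
      inner : ∀ x → 𝕊 s (λ v → (g x + Σᵛ g v) ²) ≡ N * (g x ²) + g x * (2 * M₁) + M₂
      inner x = trans (𝕊-cong s λ v → expand (g x) (Σᵛ g v))
        (trans (𝕊-+ s (λ v → g x ² + 2 * g x * Σᵛ g v) (λ v → Σᵛ g v ²)) (cong (_+ M₂)
        (trans (𝕊-+ s (λ _ → g x ²) (λ v → 2 * g x * Σᵛ g v)) (cong₂ _+_ (𝕊-const s (g x ²))
        (trans (𝕊-* s (2 * g x) (Σᵛ g)) (swap (g x) M₁))))))
      rearrange : ∀ n N G G₂ M₁ M₂ → n * n * (N * G₂ + G * (2 * M₁) + n * M₂)
        ≡ N * (n * n * G₂) + 2 * n * G * (n * M₁) + n * (n * n * M₂)
      rearrange = solve-∀
      collect : ∀ n N s G G₂ →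
        N * (n * n * G₂) + 2 * n * G * (N * (s * G)) + n * (N * (s * n * G₂ + s * s * (G * G))) + n * N * (G * G)
        ≡ n * N * ((1 + s) * n * G₂ + (1 + s) * (1 + s) * (G * G))
      collect = solve-∀

  -- Second moment method for the number of related pairs between two samples.

  module _ {n : ℕ} (R : Fin n → Fin n → ℕ) where

    pairs : ∀ {s} → Vec (Fin n) s → Vec (Fin n) s → ℕ
    pairs u v = Σᵛ (λ y → Σᵛ (λ x → R x y) u) v

    private
      A = ∑ λ x → ∑ λ y → R x y
      dˡ = λ x → ∑ λ y → R x y
      dʳ = λ y → ∑ λ x → R x y

    firstMoment-pairs : ∀ s → n ² * 𝕊 s (λ u → 𝕊 s λ v → pairs u v) ≡ (n ^ s) ² * (s ² * A)
    firstMoment-pairs s = begin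
      n ² * 𝕊 s (λ u → 𝕊 s (pairs u))
        ≡⟨ *-assoc n n _ ⟩
      n * (n * 𝕊 s (λ u → 𝕊 s (pairs u)))
        ≡⟨ cong (n *_) (𝕊-* s n (λ u → 𝕊 s (pairs u))) ⟨
      n * 𝕊 s (λ u → n * 𝕊 s (pairs u))
        ≡⟨ cong (n *_) (𝕊-cong s λ u → trans (firstMoment s (λ y → Σᵛ (λ x → R x y) u))
             (trans (cong (λ z → N * (s * z)) (Σᵛ-∑ R u)) (sym (*-assoc N s _)))) ⟩
      n * 𝕊 s (λ u → N * s * Σᵛ dˡ u)
        ≡⟨ cong (n *_) (𝕊-* s (N * s) (Σᵛ dˡ)) ⟩
      n * (N * s * 𝕊 s (Σᵛ dˡ))
        ≡⟨ swap n (N * s) (𝕊 s (Σᵛ dˡ)) ⟩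
      N * s * (n * 𝕊 s (Σᵛ dˡ))
        ≡⟨ cong (N * s *_) (firstMoment s dˡ) ⟩
      N * s * (N * (s * A))
        ≡⟨ collect N s A ⟩
      N ² * (s ² * A) ∎
      where
      open ≡-Reasoning
      N = n ^ s
      swap : ∀ a b c → a * (b * c) ≡ b * (a * c)
      swap = solve-∀
      collect : ∀ N s A → N * s * (N * (s * A)) ≡ N * N * (s * s * A)
      collect = solve-∀

    -- For fixed u the count is a sum over v with weight `w u y`, so `secondMoment` applies to v.
    -- What remains to be averaged over u is the sum of the squares of the weights, treated column
    -- by column, and the square of their total, which is a sum of left degrees over u;
    -- `secondMoment` applies to both.
    secondMoment-pairs : (∀ x y → R x y ² ≡ R x y) → ∀ s →
      n ² * (n ² * 𝕊 s (λ u → 𝕊 s λ v → pairs u v ²)) ≤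
      (n ^ s) ² * (s ² * n ² * A + s ² * s * n * (∑ (λ y → dʳ y ²) + ∑ (λ x → dˡ x ²)) + s ² * s ² * A ²)
    secondMoment-pairs idem s = begin
      n ² * (n ² * 𝕊 s (λ u → 𝕊 s λ v → pairs u v ²))
        ≡⟨ cong (n ² *_) (𝕊-* s (n ²) (λ u → 𝕊 s λ v → pairs u v ²)) ⟨
      n ² * 𝕊 s (λ u → n ² * 𝕊 s λ v → pairs u v ²)
        ≤⟨ *-monoʳ-≤ (n ²) (𝕊-mono s λ u → secondMoment s (w u)) ⟩
      n ² * 𝕊 s (λ u → N * (s * n * ∑ (λ y → w u y ²) + s ² * ∑ (w u) ²))
        ≡⟨ cong (n ² *_) split ⟩
      n ² * (N * (s * n * ∑ (λ y → 𝕊 s λ u → w u y ²) + s ² * 𝕊 s (λ u → Σᵛ dˡ u ²)))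
        ≡⟨ distribute (n ²) N (s * n) (s ²) _ _ ⟩
      N * (s * n * (n ² * ∑ (λ y → 𝕊 s λ u → w u y ²)) + s ² * (n ² * 𝕊 s (λ u → Σᵛ dˡ u ²)))
        ≤⟨ *-monoʳ-≤ N (+-mono-≤ (*-monoʳ-≤ (s * n) columns) (*-monoʳ-≤ (s ²) (secondMoment s dˡ))) ⟩
      N * (s * n * (N * (s * n * A + s ² * D)) + s ² * (N * (s * n * D′ + s ² * A ²)))
        ≡⟨ collect N s n A D D′ ⟩
      N ² * (s ² * n ² * A + s ² * s * n * (D + D′) + s ² * s ² * A ²) ∎
      where
      open ≤-Reasoning
      N = n ^ s
      D = ∑ λ y → dʳ y ²
      D′ = ∑ λ x → dˡ x ²
      w : Vec (Fin n) s → Fin n → ℕ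
      w u y = Σᵛ (λ x → R x y) u
      split : 𝕊 s (λ u → N * (s * n * ∑ (λ y → w u y ²) + s ² * ∑ (w u) ²)) ≡
              N * (s * n * ∑ (λ y → 𝕊 s λ u → w u y ²) + s ² * 𝕊 s (λ u → Σᵛ dˡ u ²))
      split = trans (𝕊-* s N _) (cong (N *_) (trans (𝕊-+ s _ _) (cong₂ _+_
        (trans (𝕊-* s (s * n) _) (cong (s * n *_) (𝕊-∑ s (λ u y → w u y ²))))
        (trans (𝕊-* s (s ²) _) (cong (s ² *_) (𝕊-cong s λ u → cong _² (Σᵛ-∑ R u)))))))
      columns : n ² * ∑ (λ y → 𝕊 s λ u → w u y ²) ≤ N * (s * n * A + s ² * D)
      columns = begin
        n ² * ∑ (λ y → 𝕊 s λ u → w u y ²)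
          ≡⟨ *-∑ (n ²) _ ⟨
        ∑ (λ y → n ² * 𝕊 s λ u → w u y ²)
          ≤⟨ ∑-mono (λ y → secondMoment s (λ x → R x y)) ⟩
        ∑ (λ y → N * (s * n * ∑ (λ x → R x y ²) + s ² * dʳ y ²))
          ≡⟨ trans (*-∑ N _) (cong (N *_) (trans (∑-+ _ _) (cong₂ _+_
               (trans (*-∑ (s * n) _) (cong (s * n *_)
                 (trans (∑-cong λ y → ∑-cong λ x → idem x y) (∑-comm λ y x → R x y))))
               (*-∑ (s ²) _)))) ⟩
        N * (s * n * A + s ² * D) ∎
      distribute : ∀ a N b c x y → a * (N * (b * x + c * y)) ≡ N * (b * (a * x) + c * (a * y))
      distribute = solve-∀
      collect : ∀ N s n A D D′ →
        N * (s * n * (N * (s * n * A + s * s * D)) + s * s * (N * (s * n * D′ + s * s * (A * A))))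
        ≡ N * N * (s * s * (n * n) * A + s * s * s * n * (D + D′) + s * s * (s * s) * (A * A))
      collect = solve-∀

    -- With E = s² A / n² the expected number of good pairs, the degree bounds
    -- give E[X²] ≤ E² (1 + 8/κ + 8/κ²), and P(X > 0) ≥ E² / E[X²].
    manyHits : ∀ κ s → .{{_ : NonZero n}} → .{{_ : NonZero s}} → .{{_ : NonZero A}} →
      (∀ x y → R x y ² ≡ R x y) →
      (∀ x → dˡ x ² ≤ 2 * A) → (∀ y → dʳ y ² ≤ 2 * A) →
      κ ² * n ² ≤ 8 * (s ² * A) →
      κ ² * (n ^ s) ² ≤ 𝕊 s (λ u → 𝕊 s λ v → 𝟙 (0 <? pairs u v)) * (κ ² + 8 * κ + 8)
    manyHits κ s idem degˡ degʳ large = *-cancelˡ-≤ (T * E ²) (begin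
      T * E ² * (κ ² * T)              ≡⟨ regroup₁ T E κ ⟩
      κ ² * (T * E) ²                  ≡⟨ cong (λ z → κ ² * z ²) (firstMoment-pairs s) ⟨
      κ ² * (n ² * M₁) ²               ≡⟨ regroup₂ κ n M₁ ⟩
      κ ² * (n ² * (n ² * M₁ ²))       ≤⟨ *-monoʳ-≤ (κ ²) (*-monoʳ-≤ (n ²) (*-monoʳ-≤ (n ²) cs)) ⟩
      κ ² * (n ² * (n ² * (G * M₂)))   ≡⟨ regroup₃ κ n G M₂ ⟩
      G * (κ ² * (n ² * (n ² * M₂)))   ≤⟨ *-monoʳ-≤ G (*-monoʳ-≤ (κ ²) (secondMoment-pairs idem s)) ⟩
      G * (κ ² * (T * (s ² * n ² * A + s ² * s * n * (D + D′) + s ² * s ² * A ²)))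
                                       ≡⟨ regroup₄ G κ T s n A D D′ ⟩
      -- The factor κ² is distributed so that `large` turns the first term into 8 E² and the two
      -- degree sums turn the middle one into 8 κ E².
      G * (T * (s ² * A * (κ ² * n ²) + s ² * s * κ * (κ * n * D + κ * n * D′) + κ ² * E ²))
        ≤⟨ *-monoʳ-≤ G (*-monoʳ-≤ T (+-monoˡ-≤ _ (+-mono-≤ (*-monoʳ-≤ (s ² * A) large)
             (*-monoʳ-≤ (s ² * s * κ) (+-mono-≤ (degrees dʳ degʳ (∑-comm λ y x → R x y)) (degrees dˡ degˡ refl)))))) ⟩
      G * (T * (s ² * A * (8 * (s ² * A)) + s ² * s * κ * (4 * s * A ² + 4 * s * A ²) + κ ² * E ²))
                                       ≡⟨ regroup₅ G T s A κ ⟩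
      T * E ² * (G * (κ ² + 8 * κ + 8)) ∎)
      where
      open ≤-Reasoning
      T = (n ^ s) ²
      E = s ² * A
      M₁ = 𝕊 s λ u → 𝕊 s λ v → pairs u v
      M₂ = 𝕊 s λ u → 𝕊 s λ v → pairs u v ²
      G = 𝕊 s λ u → 𝕊 s λ v → 𝟙 (0 <? pairs u v)
      D = ∑ λ y → dʳ y ²
      D′ = ∑ λ x → dˡ x ²
      instance
        N≢0 : NonZero (n ^ s)
        N≢0 = m^n≢0 n s
        T≢0 : NonZero T
        T≢0 = m*n≢0 (n ^ s) (n ^ s)
        s²≢0 : NonZero (s ²)
        s²≢0 = m*n≢0 s s
        E≢0 : NonZero E
        E≢0 = m*n≢0 (s ²) A
        E²≢0 : NonZero (E ²)
        E²≢0 = m*n≢0 E E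
        TE²≢0 : NonZero (T * E ²)
        TE²≢0 = m*n≢0 T (E ²)
      positive-part : ∀ z → z ² ≤ 𝟙 (0 <? z) * z ²
      positive-part zero    = z≤n
      positive-part (suc z) = ≤-reflexive (sym (+-identityʳ (suc z ²)))
      -- Second moment method: X equals X times the indicator of X > 0, so Cauchy-Schwarz bounds (E
      -- X)² by P(X > 0) E X².
      cs : M₁ ² ≤ G * M₂
      cs = 𝕊-cauchySchwarz s _ _ _ λ u → 𝕊-cauchySchwarz s _ _ _ λ v → positive-part (pairs u v)
      -- This linear bound on a single degree lets the sum of squared degrees be estimated by a
      -- maximum times the total `A`.
      degree : ∀ d → d ² ≤ 2 * A → κ * n * d ≤ 4 * s * A
      degree d le = ²-cancel-≤ (begin
        (κ * n * d) ²             ≡⟨ sq κ n d ⟩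
        κ ² * n ² * d ²           ≤⟨ *-mono-≤ large le ⟩
        8 * (s ² * A) * (2 * A)   ≡⟨ sq′ s A ⟩
        (4 * s * A) ²             ∎)
        where
        sq : ∀ a b c → a * b * c * (a * b * c) ≡ a * a * (b * b) * (c * c)
        sq = solve-∀
        sq′ : ∀ s A → 8 * (s * s * A) * (2 * A) ≡ 4 * s * A * (4 * s * A)
        sq′ = solve-∀
      degrees : ∀ d → (∀ z → d z ² ≤ 2 * A) → ∑ d ≡ A → κ * n * ∑ (λ z → d z ²) ≤ 4 * s * A ²
      degrees d le total = begin
        κ * n * ∑ (λ z → d z ²)          ≡⟨ *-∑ (κ * n) (λ z → d z ²) ⟨
        ∑ (λ z → κ * n * d z ²)          ≡⟨ ∑-cong (λ z → sym (*-assoc (κ * n) (d z) (d z))) ⟩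
        ∑ (λ z → κ * n * d z * d z)      ≤⟨ ∑-mono (λ z → *-monoˡ-≤ (d z) (degree (d z) (le z))) ⟩
        ∑ (λ z → 4 * s * A * d z)        ≡⟨ *-∑ (4 * s * A) d ⟩
        4 * s * A * ∑ d                  ≡⟨ cong (4 * s * A *_) total ⟩
        4 * s * A * A                    ≡⟨ *-assoc (4 * s) A A ⟩
        4 * s * A ²                      ∎
      regroup₁ : ∀ T E κ → T * (E * E) * (κ * κ * T) ≡ κ * κ * (T * E * (T * E))
      regroup₁ = solve-∀
      regroup₂ : ∀ κ n M → κ * κ * (n * n * M * (n * n * M)) ≡ κ * κ * (n * n * (n * n * (M * M)))
      regroup₂ = solve-∀
      regroup₃ : ∀ κ n G M → κ * κ * (n * n * (n * n * (G * M))) ≡ G * (κ * κ * (n * n * (n * n * M)))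
      regroup₃ = solve-∀
      regroup₄ : ∀ G κ T s n A D D′ →
        G * (κ * κ * (T * (s * s * (n * n) * A + s * s * s * n * (D + D′) + s * s * (s * s) * (A * A))))
        ≡ G * (T * (s * s * A * (κ * κ * (n * n)) + s * s * s * κ * (κ * n * D + κ * n * D′) + κ * κ * (s * s * A * (s * s * A))))
      regroup₄ = solve-∀
      regroup₅ : ∀ G T s A κ →
        G * (T * (s * s * A * (8 * (s * s * A)) + s * s * s * κ * (4 * s * (A * A) + 4 * s * (A * A)) + κ * κ * (s * s * A * (s * s * A))))
        ≡ T * (s * s * A * (s * s * A)) * (G * (κ * κ + 8 * κ + 8))
      regroup₅ = solve-∀

-- Runs against the erasing oracle, and the tester.

module Online where

  open Sampling
  open import Data.Nat
  open import Data.Nat.Properties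
  open import Data.Integer using (+_)

  ∣p∪q∣≤∣p∣+∣q∣ : ∀ {n} (p q : Subset n) → ∣ p ∪ q ∣ ≤ ∣ p ∣ + ∣ q ∣
  ∣p∪q∣≤∣p∣+∣q∣ []            []            = z≤n
  ∣p∪q∣≤∣p∣+∣q∣ (outside ∷ p) (outside ∷ q) = ∣p∪q∣≤∣p∣+∣q∣ p q
  ∣p∪q∣≤∣p∣+∣q∣ (outside ∷ p) (inside ∷ q)  = subst (suc ∣ p ∪ q ∣ ≤_) (sym (+-suc ∣ p ∣ ∣ q ∣)) (s≤s (∣p∪q∣≤∣p∣+∣q∣ p q))
  ∣p∪q∣≤∣p∣+∣q∣ (inside ∷ p)  (outside ∷ q) = s≤s (∣p∪q∣≤∣p∣+∣q∣ p q)
  ∣p∪q∣≤∣p∣+∣q∣ (inside ∷ p)  (inside ∷ q)  = s≤s (≤-trans (∣p∪q∣≤∣p∣+∣q∣ p q) (+-monoʳ-≤ ∣ p ∣ (n≤1+n ∣ q ∣)))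

  ∑-∈ : ∀ {n} (E : Subset n) → ∑ (λ x → 𝟙 (x ∈? E)) ≡ ∣ E ∣
  ∑-∈ []            = ∑-zero _
  ∑-∈ (inside ∷ E)  = trans (∑-suc _) (cong suc (trans
    (∑-cong λ x → 𝟙-cong (suc x ∈? inside ∷ E) (x ∈? E) drop-there Vec.there) (∑-∈ E)))
  ∑-∈ (outside ∷ E) = trans (∑-suc _) (trans
    (∑-cong λ x → 𝟙-cong (suc x ∈? outside ∷ E) (x ∈? E) drop-there Vec.there) (∑-∈ E))

  count-tabulate : ∀ {A : Set} {P : Pred A 0ℓ} (P? : Decidable P) {N} (g : Fin N → A) →
                   count P? (tabulate g) ≡ ∑ λ i → 𝟙 (P? (g i))
  count-tabulate P? {zero}  g = sym (∑-zero _)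
  count-tabulate P? {suc N} g with P? (g zero) in eq
  ... | yes _ = trans (cong suc (count-tabulate P? (g ∘ suc)))
    (sym (trans (∑-suc _) (cong (λ z → 𝟙 z + ∑ (λ i → 𝟙 (P? (g (suc i))))) eq)))
  ... | no _  = trans (count-tabulate P? (g ∘ suc))
    (sym (trans (∑-suc _) (cong (λ z → 𝟙 z + ∑ (λ i → 𝟙 (P? (g (suc i))))) eq)))

  module _ {n : ℕ} (x₀ : Fin n) where

    -- Past the end of the vector the value is x₀.
    at : ∀ {q} → Vec (Fin n) q → ℕ → Fin n
    at []      i       = x₀
    at (x ∷ v) zero    = x
    at (x ∷ v) (suc i) = at v i

    at-++ˡ : ∀ {s t} (u : Vec (Fin n) s) (v : Vec (Fin n) t) {i} → i < s → at (u ++ v) i ≡ at u i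
    at-++ˡ (x ∷ u) v {zero}  _        = refl
    at-++ˡ (x ∷ u) v {suc i} (s≤s lt) = at-++ˡ u v lt

    at-++ʳ : ∀ {s t} (u : Vec (Fin n) s) (v : Vec (Fin n) t) i → at (u ++ v) (s + i) ≡ at v i
    at-++ʳ []      v i = refl
    at-++ʳ (x ∷ u) v i = at-++ʳ u v i

    Σᵛ-pos : ∀ {s} g (v : Vec (Fin n) s) → 0 < Σᵛ g v → ∃[ i ] (i < s × 0 < g (at v i))
    Σᵛ-pos g (x ∷ v) pos with g x in eq
    ... | suc _ = zero , s≤s z≤n , subst (0 <_) (sym eq) (s≤s z≤n)
    ... | zero with i , i<s , p ← Σᵛ-pos g v pos = suc i , s≤s i<s , p

    -- Grows at the end, as the reversed history does, so the queries of a run match it round by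
    -- round.
    prefix : ∀ {q} → Vec (Fin n) q → ∀ i → Vec (Fin n) i
    prefix v zero    = []
    prefix v (suc i) = prefix v i ∷ʳ at v i

    prefix-∷ : ∀ {q} x (v : Vec (Fin n) q) i → prefix (x ∷ v) (suc i) ≡ x ∷ prefix v i
    prefix-∷ x v zero    = refl
    prefix-∷ x v (suc i) = cong (_∷ʳ at v i) (prefix-∷ x v i)

    prefix-full : ∀ {q} (v : Vec (Fin n) q) → prefix v q ≡ v
    prefix-full []                = refl
    prefix-full {suc q} (x ∷ v) = trans (prefix-∷ x v q) (cong (x ∷_) (prefix-full v))

    -- The state of the game is abstract: the bound below rests only on the erased set being a
    -- function of the earlier samples and growing by at most t per round.
    module Erasures {t : ℕ} {State : Set} (step : State → Fin n → State) (erased : State → Subset n)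
                    (grow : ∀ σ x → ∣ erased (step σ x) ∣ ≤ ∣ erased σ ∣ + t) where

      hits : ∀ {q} → State → Vec (Fin n) q → ℕ
      hits σ []      = 0
      hits σ (x ∷ v) = 𝟙 (x ∈? erased σ) + hits (step σ x) v

      -- The set erased before sample i depends on earlier samples only and has at most e + i t
      -- elements, so the fresh uniform sample lands in it with probability at most (e + i t) / n.
      -- Every i is rounded up to q.
      hits-bound : ∀ q σ → n * 𝕊 q (hits σ) ≤ n ^ q * (q * (∣ erased σ ∣ + q * t))
      hits-bound zero    σ = ≤-reflexive (*-zeroʳ n)
      hits-bound (suc q) σ = begin
        n * ∑ (λ x → 𝕊 q λ v → 𝟙 (x ∈? erased σ) + hits (step σ x) v)
          ≡⟨ cong (n *_) (trans (∑-cong λ x → trans (𝕊-+ q _ _) (cong (_+ 𝕊 q (hits (step σ x))) (𝕊-const q (𝟙 (x ∈? erased σ)))))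
               (trans (∑-+ _ _) (cong (_+ ∑ (λ x → 𝕊 q (hits (step σ x)))) (trans (*-∑ N _) (cong (N *_) (∑-∈ (erased σ))))))) ⟩
        n * (N * e + ∑ (λ x → 𝕊 q (hits (step σ x))))
          ≡⟨ *-distribˡ-+ n (N * e) _ ⟩
        n * (N * e) + n * ∑ (λ x → 𝕊 q (hits (step σ x)))
          ≡⟨ cong (_+_ (n * (N * e))) (sym (*-∑ n _)) ⟩
        n * (N * e) + ∑ (λ x → n * 𝕊 q (hits (step σ x)))
          ≤⟨ +-monoʳ-≤ (n * (N * e)) (∑-bound (N * (q * (e + t + q * t))) λ x →
               ≤-trans (hits-bound q (step σ x)) (*-monoʳ-≤ N (*-monoʳ-≤ q (+-monoˡ-≤ (q * t) (grow σ x))))) ⟩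
        n * (N * e) + n * (N * (q * (e + t + q * t)))
          ≤⟨ m≤m+n _ (n * N * (t + q * t)) ⟩
        n * (N * e) + n * (N * (q * (e + t + q * t))) + n * N * (t + q * t)
          ≡⟨ collect n N e q t ⟩
        n * N * (suc q * (e + suc q * t)) ∎
        where
        open ≤-Reasoning
        N = n ^ q
        e = ∣ erased σ ∣
        collect : ∀ n N e q t → n * (N * e) + n * (N * (q * (e + t + q * t))) + n * N * (t + q * t)
          ≡ n * N * ((1 + q) * (e + (1 + q) * t))
        collect = solve-∀

      reach : ∀ {q} → State → Vec (Fin n) q → ℕ → State
      reach σ v zero    = σ
      reach σ v (suc i) = step (reach σ v i) (at v i)

      reach-∷ : ∀ {q} σ x (v : Vec (Fin n) q) i → reach σ (x ∷ v) (suc i) ≡ reach (step σ x) v i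
      reach-∷ σ x v zero    = refl
      reach-∷ σ x v (suc i) = cong (λ τ → step τ (at v i)) (reach-∷ σ x v i)

      no-hits : ∀ {q} σ (v : Vec (Fin n) q) → hits σ v ≡ 0 → ∀ {i} → i < q → at v i ∉ erased (reach σ v i)
      no-hits σ (x ∷ v) none {zero}  _       x∈E =
        0≢1+n (trans (sym (m+n≡0⇒m≡0 _ none)) (𝟙-yes (x ∈? erased σ) x∈E))
      no-hits σ (x ∷ v) none {suc i} (s≤s lt) x∈E = no-hits (step σ x) v (m+n≡0⇒n≡0 (𝟙 (x ∈? erased σ)) none) lt
        (subst (λ τ → at v i ∈ erased τ) (reach-∷ σ x v i) x∈E)

    -- Answers come most recent first, so an answer with i older ones behind it belongs to query
    -- number i. Erased answers are never seen.
    data Sees {q} (v : Vec (Fin n) q) : ∀ {i} → Vec Answer i → Fin n → ℝ → Set where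
      here  : ∀ {i a} {as : Vec Answer i} → Sees v (just a ∷ as) (at v i) a
      there : ∀ {i a b x} {as : Vec Answer i} → Sees v as x a → Sees v (b ∷ as) x a

    Sees-resp-≃ : ∀ {q i x a} {v : Vec (Fin n) q} {as bs : Vec Answer i} → as ≃ᵃ bs →
                  Sees v as x a → ∃[ b ] (Sees v bs x b × a ≃ b)
    Sees-resp-≃ (Maybe.just {y = b} a≃b Vec.∷ _) here = b , here , a≃b
    Sees-resp-≃ (_ Vec.∷ eqs) (there s) with b , s′ , a≃b ← Sees-resp-≃ eqs s = b , there s′ , a≃b

    Violation : ∀ {q i} → Vec (Fin n) q → Vec Answer i → Set
    Violation v as = ∃[ x ] ∃[ y ] ∃[ a ] ∃[ b ] (Sees v as x a × Sees v as y b × x <ᶠ y × b Defs.< a)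

    Violation-resp-≃ : ∀ {q i} {v : Vec (Fin n) q} {as bs : Vec Answer i} → as ≃ᵃ bs → Violation v as → Violation v bs
    Violation-resp-≃ eqs (x , y , a , b , sx , sy , x<y , b<a) =
      let a′ , sx′ , a≃a′ = Sees-resp-≃ eqs sx
          b′ , sy′ , b≃b′ = Sees-resp-≃ eqs sy
      in x , y , a′ , b′ , sx′ , sy′ , x<y ,
         Real.≤-<-trans b′ b a′ (proj₂ b≃b′) (Real.<-≤-trans b a a′ b<a (proj₁ a≃a′))

  Pr≡ : ∀ {N} .{{_ : NonZero N}} {P : Pred (Fin N) 0ℓ} (P? : Decidable P) →
        Pr P? ≡ + ∑ (λ ω → 𝟙 (P? ω)) ℚ./ N
  Pr≡ {N} P? = cong (λ c → + c ℚ./ N) (count-tabulate P? id)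

  𝕊-≡ : ∀ {n q} (z : Vec (Fin n) q) → 𝕊 q (λ v → 𝟙 (≡-dec _≟ᶠ_ v z)) ≡ 1
  𝕊-≡ []      = refl
  𝕊-≡ {n} {suc q} (y ∷ z) = begin
    ∑ (λ x → 𝕊 q λ v → 𝟙 (≡-dec _≟ᶠ_ (x ∷ v) (y ∷ z)))
      ≡⟨ ∑-cong (λ x → 𝕊-cong q λ v → 𝟙-× (x ≟ᶠ y) (≡-dec _≟ᶠ_ v z) (≡-dec _≟ᶠ_ (x ∷ v) (y ∷ z)) (cong₂ _∷_) ∷-injective) ⟨
    ∑ (λ x → 𝕊 q λ v → 𝟙 (x ≟ᶠ y) * 𝟙 (≡-dec _≟ᶠ_ v z))
      ≡⟨ ∑-cong (λ x → trans (𝕊-* q (𝟙 (x ≟ᶠ y)) _) (trans (cong (𝟙 (x ≟ᶠ y) *_) (𝕊-≡ z)) (*-identityʳ _))) ⟩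
    ∑ (λ x → 𝟙 (x ≟ᶠ y))
      ≡⟨ ∑-𝟙 y ⟩
    1 ∎
    where open ≡-Reasoning

  ∏-const : ∀ n .{{_ : NonZero n}} q .{{_ : NonZero (n ^ q)}} {g : Fin q → ℚ} → (∀ j → g j ≡ + 1 ℚ./ n) → ∏ g ≡ + 1 ℚ./ (n ^ q)
  ∏-const n zero    eq = refl
  ∏-const n (suc q) eq = trans (cong₂ ℚ._*_ (eq zero) (∏-const n q (eq ∘ suc))) (Real./-* 1 n 1 (n ^ q))
    where
    instance
      n^q≢0 : NonZero (n ^ q)
      n^q≢0 = m^n≢0 n q

  does-cong : ∀ {P Q : Set} (P? : Dec P) (Q? : Dec Q) → (P → Q) → (Q → P) → does P? ≡ does Q?
  does-cong (yes p) (yes q) to from = refl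
  does-cong (yes p) (no ¬q) to from = ⊥-elim (¬q (to p))
  does-cong (no ¬p) (yes q) to from = ⊥-elim (¬p (from q))
  does-cong (no ¬p) (no ¬q) to from = refl

  module Tester (em : ExcludedMiddle 0ℓ) {n : ℕ} (x₀ : Fin n) (q : ℕ) where

    private
      instance
        n≢0 : NonZero n
        n≢0 = nonZeroIndex x₀
        n^q≢0 : NonZero (n ^ q)
        n^q≢0 = m^n≢0 n q

    tester : Algorithm n q
    tester = record
      { coins       = n ^ q
      -- The number `i` of answers received is the index of the next sample; the answers themselves
      -- are ignored.
      ; query       = λ ω {i} _ → at x₀ (decode q ω) i
      ; accept      = λ ω as → not (does (em {Violation x₀ (decode q ω) as}))
      ; query-cong  = λ _ _ → refl
      ; accept-cong = λ ω eqs → cong not (does-cong em em (Violation-resp-≃ x₀ eqs)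
          (Violation-resp-≃ x₀ (Vec.sym (Maybe.sym λ (x≤y , y≤x) → y≤x , x≤y) eqs)))
      }

    nonadaptive : Nonadaptive tester
    nonadaptive ω as bs = refl

    module _ {t : ℕ} (f : Fin n → ℝ) (S : Adversary n t) where

      State : Set
      State = ∃[ i ] (History n i × Subset n)

      σ₀ : State
      σ₀ = 0 , [] , ∅

      step : State → Fin n → State
      step (i , h , E) x = suc i , h′ , E ∪ erase S h′
        where h′ = (x , oracle tester f S E x) ∷ h

      erased : State → Subset n
      erased (_ , _ , E) = E

      open Erasures x₀ {t} step erased
        (λ (i , h , E) x → ≤-trans (∣p∪q∣≤∣p∣+∣q∣ E _) (+-monoʳ-≤ ∣ E ∣ (budget S _))) public

      reach≡run : ∀ ω i → reach σ₀ (decode q ω) i ≡ (i , run tester f S ω i)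
      reach≡run ω zero    = refl
      reach≡run ω (suc i) = cong (λ σ → step σ (at x₀ (decode q ω) i)) (reach≡run ω i)

      answers : Fin (n ^ q) → ∀ i → Vec Answer i
      answers ω i = map proj₂ (proj₁ (run tester f S ω i))

      oracle-just : ∀ E x {a} → oracle tester f S E x ≡ just a → a ≡ f x
      oracle-just E x eq with does (x ∈? E) | eq
      ... | false | refl = refl

      oracle-∉ : ∀ E x → x ∉ E → oracle tester f S E x ≡ just (f x)
      oracle-∉ E x x∉E with x ∈? E
      ... | yes x∈E = ⊥-elim (x∉E x∈E)
      ... | no _    = refl

      Sees-∷ : ∀ {i x a b} {v : Vec (Fin n) q} {as : Vec Answer i} →
               Sees x₀ v (b ∷ as) x a → (b ≡ just a × x ≡ at x₀ v i) ⊎ Sees x₀ v as x a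
      Sees-∷ here      = inj₁ (refl , refl)
      Sees-∷ (there s) = inj₂ s

      sees⇒value : ∀ ω i {x a} → Sees x₀ (decode q ω) (answers ω i) x a → a ≡ f x
      sees⇒value ω (suc i) s with Sees-∷ s
      ... | inj₁ (eq , refl) = oracle-just (proj₂ (run tester f S ω i)) _ eq
      ... | inj₂ s′          = sees⇒value ω i s′

      -- Only erasures made before round i can hide the answer of round i; once recorded, it stays
      -- in the history.
      sees-unerased : ∀ ω {i j} → i < j → at x₀ (decode q ω) i ∉ proj₂ (run tester f S ω i) →
                      Sees x₀ (decode q ω) (answers ω j) (at x₀ (decode q ω) i) (f (at x₀ (decode q ω) i))
      sees-unerased ω {i} {suc j} i<1+j unerased with m≤n⇒m<n∨m≡n (≤-pred i<1+j)
      ... | inj₁ i<j  = there (sees-unerased ω i<j unerased)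
      ... | inj₂ refl = subst (λ b → Sees x₀ (decode q ω) (b ∷ answers ω i) x (f x)) (sym (oracle-∉ _ x unerased)) here
        where x = at x₀ (decode q ω) i

      queries≡decode : ∀ ω → queries tester f S ω ≡ decode q ω
      queries≡decode ω = trans (go q) (prefix-full x₀ (decode q ω))
        where
        go : ∀ i → reverse (map proj₁ (proj₁ (run tester f S ω i))) ≡ prefix x₀ (decode q ω) i
        go zero    = refl
        go (suc i) = trans (reverse-∷ _ (map proj₁ (proj₁ (run tester f S ω i)))) (cong (_∷ʳ at x₀ (decode q ω) i) (go i))

      uniform : ∀ j x → Pr (λ ω → lookup (queries tester f S ω) j ≟ᶠ x) ≡ + 1 ℚ./ n
      uniform j x = trans (Pr≡ (λ ω → lookup (queries tester f S ω) j ≟ᶠ x)) (Real./-cong c (n ^ q) 1 n (begin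
        c * n                                              ≡⟨ *-comm c n ⟩
        n * c                                              ≡⟨ cong (n *_) (∑-cong λ ω → cong (λ v → 𝟙 (lookup v j ≟ᶠ x)) (queries≡decode ω)) ⟩
        n * ∑ (λ ω → 𝟙 (lookup (decode q ω) j ≟ᶠ x))       ≡⟨ cong (n *_) (∑-decode q (λ v → 𝟙 (lookup v j ≟ᶠ x))) ⟩
        n * 𝕊 q (λ v → 𝟙 (lookup v j ≟ᶠ x))                ≡⟨ 𝕊-lookup q j x ⟩
        n ^ q                                              ≡⟨ *-identityˡ (n ^ q) ⟨
        1 * n ^ q                                          ∎))
        where
        open ≡-Reasoning
        c = ∑ λ ω → 𝟙 (lookup (queries tester f S ω) j ≟ᶠ x)

      independent : ∀ z → Pr (λ ω → ≡-dec _≟ᶠ_ (queries tester f S ω) z) ≡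
                    ∏ (λ j → Pr (λ ω → lookup (queries tester f S ω) j ≟ᶠ lookup z j))
      independent z = trans (Pr≡ (λ ω → ≡-dec _≟ᶠ_ (queries tester f S ω) z)) (trans (cong (λ c → + c ℚ./ (n ^ q)) (begin
        ∑ (λ ω → 𝟙 (≡-dec _≟ᶠ_ (queries tester f S ω) z))
          ≡⟨ ∑-cong (λ ω → cong (λ v → 𝟙 (≡-dec _≟ᶠ_ v z)) (queries≡decode ω)) ⟩
        ∑ (λ ω → 𝟙 (≡-dec _≟ᶠ_ (decode q ω) z))
          ≡⟨ ∑-decode q (λ v → 𝟙 (≡-dec _≟ᶠ_ v z)) ⟩
        𝕊 q (λ v → 𝟙 (≡-dec _≟ᶠ_ v z))
          ≡⟨ 𝕊-≡ z ⟩
        1 ∎)) (sym (∏-const n q λ j → uniform j (lookup z j))))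
        where open ≡-Reasoning

      accepts-sorted : Sorted f → Pr[accept] tester f S ≡ 1ℚ
      accepts-sorted sorted = trans (Pr≡ (λ ω → output tester f S ω ≟ᵇ true)) (Real./-cong acceptances (n ^ q) 1 1 (trans (*-identityʳ _) (begin
        acceptances                                 ≡⟨ ∑-cong (λ ω → 𝟙-yes (_ ≟ᵇ true) (accepted ω)) ⟩
        ∑ {n ^ q} (λ ω → 1)                         ≡⟨ ∑-const (n ^ q) 1 ⟩
        n ^ q * 1                                   ≡⟨ *-comm (n ^ q) 1 ⟩
        1 * n ^ q                                   ∎)))
        where
        open ≡-Reasoning
        acceptances = ∑ λ ω → 𝟙 (output tester f S ω ≟ᵇ true)
        accepted : ∀ ω → output tester f S ω ≡ true
        accepted ω with em {Violation x₀ (decode q ω) (answers ω q)}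
        ... | no _ = refl
        ... | yes (x , y , a , b , sx , sy , x<y , b<a)
          with refl ← sees⇒value ω q sx | refl ← sees⇒value ω q sy = ⊥-elim (sorted x y x<y b<a)

      -- Unlike `Violation`, this ignores erasures, so it depends on the samples alone and its
      -- probability is free of the adversary.
      Collision : Vec (Fin n) q → Set
      Collision v = ∃[ i ] ∃[ j ] (i < q × j < q × at x₀ v i <ᶠ at x₀ v j × f (at x₀ v j) Defs.< f (at x₀ v i))

      rejects-collision : ∀ ω → Collision (decode q ω) → hits σ₀ (decode q ω) ≡ 0 → output tester f S ω ≡ false
      rejects-collision ω (i , j , i<q , j<q , x<y , fy<fx) none with em {Violation x₀ (decode q ω) (answers ω q)}
      ... | yes _ = refl
      ... | no ¬v = ⊥-elim (¬v (_ , _ , _ , _ , seen i<q , seen j<q , x<y , fy<fx))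
        where
        seen : ∀ {i} → i < q → Sees x₀ (decode q ω) (answers ω q) (at x₀ (decode q ω) i) (f (at x₀ (decode q ω) i))
        seen {i} i<q = sees-unerased ω i<q (subst (λ σ → at x₀ (decode q ω) i ∉ erased σ) (reach≡run ω i)
          (no-hits σ₀ (decode q ω) none i<q))

      -- Opaque to keep conversion checking from unfolding the runs of the tester.
      opaque

        rejections : ℕ
        rejections = ∑ λ ω → 𝟙 (output tester f S ω ≟ᵇ false)

        -- Union bound: coins with a collision either lead to rejection or contribute at least one
        -- hit. Counting hits rather than the event of a hit turns its probability into an
        -- expectation.
        collisions-bound : 𝕊 q (λ v → 𝟙 (em {Collision v})) ≤ rejections + 𝕊 q (hits σ₀)
        collisions-bound = begin
          𝕊 q (λ v → 𝟙 (em {Collision v}))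
            ≡⟨ ∑-decode q (λ v → 𝟙 (em {Collision v})) ⟨
          ∑ (λ ω → 𝟙 (em {Collision (decode q ω)}))
            ≤⟨ ∑-mono (λ ω → 𝟙-bound em (caught ω)) ⟩
          ∑ (λ ω → 𝟙 (output tester f S ω ≟ᵇ false) + hits σ₀ (decode q ω))
            ≡⟨ ∑-+ _ _ ⟩
          rejections + ∑ (λ ω → hits σ₀ (decode q ω))
            ≡⟨ cong (_+_ rejections) (∑-decode q (hits σ₀)) ⟩
          rejections + 𝕊 q (hits σ₀) ∎
          where
          open ≤-Reasoning
          caught : ∀ ω → Collision (decode q ω) → 1 ≤ 𝟙 (output tester f S ω ≟ᵇ false) + hits σ₀ (decode q ω)
          caught ω c with hits σ₀ (decode q ω) in eq
          ... | zero  = ≤-trans (≤-reflexive (sym (𝟙-yes (_ ≟ᵇ false) (rejects-collision ω c eq)))) (m≤m+n _ 0)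
          ... | suc k = ≤-trans (s≤s z≤n) (m≤n+m (suc k) _)

        Pr[reject]≥⅔ : 2 * n ^ q ≤ 3 * rejections → + 2 ℚ./ 3 ℚ.≤ Pr[reject] tester f S
        Pr[reject]≥⅔ le = ℚ.≤-trans (Real./-mono-≤ 2 3 rejections (n ^ q) (≤-trans le (≤-reflexive (*-comm 3 rejections))))
          (ℚ.≤-reflexive (sym (Pr≡ (λ ω → output tester f S ω ≟ᵇ false))))

-- Matchings of violating pairs and repair of the unmatched part.

module Violations where

  open Sampling
  open import Data.Nat
  open import Data.Nat.Properties
  open Online

  -- Adds the edge between `a` and `b` to the matching that `p` encodes, when both are still fixed
  -- points.
  link : ∀ {n} → (Fin n → Fin n) → Fin n → Fin n → Fin n → Fin n
  link p a b z = if does (z ≟ᶠ a) then b else if does (z ≟ᶠ b) then a else p z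

  module _ {n : ℕ} (p : Fin n → Fin n) {a b : Fin n} (a≢b : a ≢ b) where

    link-a : link p a b a ≡ b
    link-a with a ≟ᶠ a
    ... | yes _  = refl
    ... | no a≢a = ⊥-elim (a≢a refl)

    link-b : link p a b b ≡ a
    link-b with b ≟ᶠ a | b ≟ᶠ b
    ... | yes b≡a | _      = b≡a
    ... | no _    | yes _  = refl
    ... | no _    | no b≢b = ⊥-elim (b≢b refl)

    link-other : ∀ {z} → z ≢ a → z ≢ b → link p a b z ≡ p z
    link-other {z} z≢a z≢b with z ≟ᶠ a | z ≟ᶠ b
    ... | yes z≡a | _       = ⊥-elim (z≢a z≡a)
    ... | no _    | yes z≡b = ⊥-elim (z≢b z≡b)
    ... | no _    | no _    = refl

    link-involutive : p a ≡ a → p b ≡ b → (∀ z → p (p z) ≡ z) → ∀ z → link p a b (link p a b z) ≡ z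
    link-involutive pa≡a pb≡b inv z with z ≟ᶠ a | z ≟ᶠ b
    ... | yes refl | _        = link-b
    ... | no _     | yes refl = link-a
    ... | no z≢a   | no z≢b   = trans (link-other (moved pa≡a z≢a) (moved pb≡b z≢b)) (inv z)
      where
      moved : ∀ {c} → p c ≡ c → z ≢ c → p z ≢ c
      moved pc≡c z≢c pz≡c = z≢c (trans (sym (inv z)) (trans (cong p pz≡c) pc≡c))

    link-fixed : ∀ {z} → link p a b z ≡ z → z ≢ a × z ≢ b × p z ≡ z
    link-fixed {z} eq with z ≟ᶠ a | z ≟ᶠ b
    ... | yes refl | _        = ⊥-elim (a≢b (sym eq))
    ... | no _     | yes refl = ⊥-elim (a≢b eq)
    ... | no z≢a   | no z≢b   = z≢a , z≢b , eq

  -- A matching of positions is encoded as the involution p exchanging the two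
  -- endpoints of each edge; the unmatched positions are its fixed points.
  record ViolationMatching {n} (f : Fin n → ℝ) (p : Fin n → Fin n) : Set where
    field
      involutive : ∀ x → p (p x) ≡ x
      violating  : ∀ x → x <ᶠ p x → f (p x) Defs.< f x

  open ViolationMatching

  module _ (em : ExcludedMiddle 0ℓ) {n : ℕ} (f : Fin n → ℝ) where

    -- Positions are scanned from left to right. Position j is linked to an unmatched earlier
    -- position with a larger value if there is one; otherwise it extends the sorted sequence of
    -- unmatched positions. The last component keeps the positions not yet scanned free.
    greedyMatching : ∀ j → j ≤ n → ∃[ p ] (ViolationMatching f p
      × (∀ x y → p x ≡ x → p y ≡ y → x <ᶠ y → toℕ y < j → f x Defs.≤ f y)
      × (∀ x → j ≤ toℕ x → p x ≡ x))
    greedyMatching zero    j≤n = (λ x → x)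
      , record { involutive = λ _ → refl ; violating = λ x x<x → ⊥-elim (<-irrefl refl x<x) }
      , (λ _ _ _ _ _ ()) , (λ _ _ → refl)
    greedyMatching (suc j) j<n with p , M , sorted , fixed ← greedyMatching j (<⇒≤ j<n) = extend em
      where
      y = fromℕ< j<n
      y≡j : toℕ y ≡ j
      y≡j = toℕ-fromℕ< j<n
      py≡y : p y ≡ y
      py≡y = fixed y (≤-reflexive (sym y≡j))
      extend : Dec (∃[ x ] (x <ᶠ y × p x ≡ x × f y Defs.< f x)) → ∃[ p′ ] (ViolationMatching f p′
        × (∀ x y → p′ x ≡ x → p′ y ≡ y → x <ᶠ y → toℕ y < suc j → f x Defs.≤ f y)
        × (∀ x → suc j ≤ toℕ x → p′ x ≡ x))
      extend (no ¬∃) = p , M , sorted′ , λ x le → fixed x (<⇒≤ le)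
        where
        sorted′ : ∀ x y → p x ≡ x → p y ≡ y → x <ᶠ y → toℕ y < suc j → f x Defs.≤ f y
        sorted′ x z px pz x<z z<1+j with m≤n⇒m<n∨m≡n (≤-pred z<1+j)
        ... | inj₁ z<j = sorted x z px pz x<z z<j
        ... | inj₂ z≡j with refl ← toℕ-injective (trans z≡j (sym y≡j)) = λ fy<fx → ¬∃ (x , x<z , px , fy<fx)
      extend (yes (x , x<y , px≡x , fy<fx)) = link p x y
        , record { involutive = link-involutive p x≢y px≡x py≡y (involutive M) ; violating = violating′ }
        , sorted′ , fixed′
        where
        x≢y : x ≢ y
        x≢y refl = <-irrefl refl x<y
        violating′ : ∀ z → z <ᶠ link p x y z → f (link p x y z) Defs.< f z
        violating′ z lt = by-cases (z ≟ᶠ x) (z ≟ᶠ y)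
          where
          by-cases : Dec (z ≡ x) → Dec (z ≡ y) → f (link p x y z) Defs.< f z
          by-cases (yes refl) _ = subst (λ w → f w Defs.< f x) (sym (link-a p x≢y)) fy<fx
          by-cases (no _) (yes refl) = ⊥-elim (<-asym x<y (subst (y <ᶠ_) (link-b p x≢y) lt))
          by-cases (no z≢x) (no z≢y) = subst (λ w → f w Defs.< f z) (sym eq)
            (violating M z (subst (z <ᶠ_) eq lt))
            where eq = link-other p x≢y z≢x z≢y
        sorted′ : ∀ u z → link p x y u ≡ u → link p x y z ≡ z → u <ᶠ z → toℕ z < suc j → f u Defs.≤ f z
        sorted′ u z eu ez u<z z<1+j =
          let _ , _ , pu≡u = link-fixed p x≢y eu
              _ , z≢y , pz≡z = link-fixed p x≢y ez
          in sorted u z pu≡u pz≡z u<z (≤∧≢⇒< (≤-pred z<1+j) λ z≡j → z≢y (toℕ-injective (trans z≡j (sym y≡j))))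
        fixed′ : ∀ z → suc j ≤ toℕ z → link p x y z ≡ z
        fixed′ z j<z = trans (link-other p x≢y
          (λ { refl → <-asym j<z (subst (toℕ x <_) y≡j x<y) })
          (λ { refl → <-irrefl (sym y≡j) j<z })) (fixed z (<⇒≤ j<z))

    maximalMatching : ∃[ p ] (ViolationMatching f p × (∀ x y → p x ≡ x → p y ≡ y → x <ᶠ y → f x Defs.≤ f y))
    maximalMatching with p , M , sorted , _ ← greedyMatching n ≤-refl =
      p , M , λ x y px py x<y → sorted x y px py x<y (toℕ<n y)

  -- Supplies the value that `repair` uses before the first unmatched position.
  lowerBound : ExcludedMiddle 0ℓ → ∀ {n} (f : Fin n → ℝ) → ∃[ c ] (∀ x → c Defs.≤ f x)
  lowerBound em {zero}  f = fromℕ 0 , λ ()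
  lowerBound em {suc n} f with lowerBound em (f ∘ suc)
  ... | c , c≤ = choose em
    where
    choose : Dec (f zero Defs.< c) → ∃[ c ] (∀ x → c Defs.≤ f x)
    choose (yes f₀<c) = f zero , λ
      { zero    → Real.≤-refl (f zero)
      ; (suc x) → Real.≤-trans (f zero) c (f (suc x)) (Real.<⇒≤ (f zero) c f₀<c) (c≤ x) }
    choose (no c≤f₀) = c , λ { zero → c≤f₀ ; (suc x) → c≤ x }

  -- The parameter `c` is an accumulator holding the last value written, so a position outside `U`
  -- copies the nearest kept value to its left.
  repair : ∀ {n} → (Fin n → ℝ) → (Fin n → Bool) → ℝ → Fin n → ℝ
  repair f U c zero    = if U zero then f zero else c
  repair f U c (suc x) = repair (f ∘ suc) (U ∘ suc) (repair f U c zero) x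

  repair-keep : ∀ {n} (f : Fin n → ℝ) U c x → U x ≡ true → repair f U c x ≡ f x
  repair-keep f U c zero    eq = cong (if_then f zero else c) eq
  repair-keep f U c (suc x) eq = repair-keep (f ∘ suc) (U ∘ suc) (repair f U c zero) x eq

  -- The lower bound is proved together with sortedness because the induction compares the head with
  -- the whole tail through the accumulator.
  repair-sorted : ∀ {n} (f : Fin n → ℝ) U c → (∀ x → U x ≡ true → c Defs.≤ f x) →
    (∀ x y → U x ≡ true → U y ≡ true → x <ᶠ y → f x Defs.≤ f y) →
    (∀ x → c Defs.≤ repair f U c x) × Sorted (repair f U c)
  repair-sorted {zero}  f U c low sorted = (λ ()) , λ ()
  repair-sorted {suc n} f U c low sorted =
      (λ { zero → c≤c′ ; (suc x) → Real.≤-trans c c′ (repair f U c (suc x)) c≤c′ (proj₁ tail x) })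
    , λ { zero    (suc y) _         → proj₁ tail y
        ; (suc x) (suc y) (s≤s x<y) → proj₂ tail x y x<y }
    where
    c′ = repair f U c zero
    if-≥ : ∀ b {a} → (b ≡ true → c Defs.≤ a) → c Defs.≤ (if b then a else c)
    if-≥ true  h = h refl
    if-≥ false h = Real.≤-refl c
    if-≤ : ∀ b {a} z → (b ≡ true → a Defs.≤ z) → c Defs.≤ z → (if b then a else c) Defs.≤ z
    if-≤ true  z h h′ = h refl
    if-≤ false z h h′ = h′
    c≤c′ : c Defs.≤ c′
    c≤c′ = if-≥ (U zero) {f zero} (low zero)
    tail = repair-sorted (f ∘ suc) (U ∘ suc) c′
      (λ x Ux → if-≤ (U zero) {f zero} (f (suc x)) (λ U₀ → sorted zero (suc x) U₀ Ux (s≤s z≤n)) (low (suc x) Ux))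
      (λ x y Ux Uy x<y → sorted (suc x) (suc y) Ux Uy (s≤s x<y))

  -- Good pairs obtained from a matching.

  module _ {n : ℕ} {f : Fin n → ℝ} {p : Fin n → Fin n} (M : ViolationMatching f p) where

    private
      m = ∑ λ x → 𝟙 (x <ᶠ? p x)

    -- A matched position is a left or a right endpoint, and `p` exchanges the two kinds, so there
    -- are m of each.
    ∣matched∣≤2m : (D : Subset n) → (∀ x → x ∈ D → p x ≢ x) → ∣ D ∣ ≤ 2 * m
    ∣matched∣≤2m D matched = begin
      ∣ D ∣                                                ≡⟨ ∑-∈ D ⟨
      ∑ (λ x → 𝟙 (x ∈? D))                                 ≤⟨ ∑-mono (λ x → 𝟙-bound (x ∈? D) (endpoint x ∘ matched x)) ⟩
      ∑ (λ x → 𝟙 (x <ᶠ? p x) + 𝟙 (p x <ᶠ? x))              ≡⟨ ∑-+ _ _ ⟩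
      m + ∑ (λ x → 𝟙 (p x <ᶠ? x))                          ≡⟨ cong (m +_) (∑-involution {p = p} (involutive M) (λ x → 𝟙 (p x <ᶠ? x))) ⟨
      m + ∑ (λ x → 𝟙 (p (p x) <ᶠ? p x))                    ≡⟨ cong (m +_) (∑-cong λ x → cong (λ z → 𝟙 (z <ᶠ? p x)) (involutive M x)) ⟩
      m + m                                                ≡⟨ cong (m +_) (+-identityʳ m) ⟨
      2 * m                                                ∎
      where
      open ≤-Reasoning
      endpoint : ∀ x → p x ≢ x → 1 ≤ 𝟙 (x <ᶠ? p x) + 𝟙 (p x <ᶠ? x)
      endpoint x px≢x with <ᶠ-cmp x (p x)
      ... | tri< x<px _ _ = ≤-trans (≤-reflexive (sym (𝟙-yes (x <ᶠ? p x) x<px))) (m≤m+n _ _)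
      ... | tri≈ _ x≡px _ = ⊥-elim (px≢x (sym x≡px))
      ... | tri> _ _ px<x = ≤-trans (≤-reflexive (sym (𝟙-yes (p x <ᶠ? x) px<x))) (m≤n+m _ _)

    module GoodPairs {r : ℕ} (idx : Fin n → Fin r) where

      Same : Fin n → Fin n → Set
      Same x y = x <ᶠ p x × y <ᶠ p y × idx x ≡ idx y

      same? : ∀ x y → Dec (Same x y)
      same? x y = (x <ᶠ? p x) ×-dec (y <ᶠ? p y) ×-dec (idx x ≟ᶠ idx y)

      ordered? : ∀ x y → Dec (Same x y × x ≤ᶠ y)
      ordered? x y = same? x y ×-dec (x ≤ᶠ? y)

      -- A left endpoint x and the right endpoint y of an edge whose left
      -- endpoint p y has the same value as x and lies weakly to its right.
      R : Fin n → Fin n → ℕ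
      R x y = 𝟙 (ordered? x (p y))

      private
        A = ∑ λ x → ∑ λ y → R x y
        Q = ∑ λ x → ∑ λ y → 𝟙 (same? x y)

      -- The chain is x ≤ p y < y for positions, and f y < f (p y) ≤ f x for values, the last step
      -- because x and p y share a group.
      R-violating : (∀ x y → idx x ≡ idx y → f x Defs.≤ f y) → ∀ x y → 0 < R x y → x <ᶠ y × f y Defs.< f x
      R-violating resp x y pos with (_ , py<ppy , eq) , x≤py ← 𝟙-pos (ordered? x (p y)) pos =
        ≤-<-trans x≤py (subst (p y <ᶠ_) ppy≡y py<ppy) ,
        Real.<-≤-trans (f y) (f (p y)) (f x) (subst (λ z → f z Defs.< f (p y)) ppy≡y (violating M (p y) py<ppy))
          (resp (p y) x (sym eq))
        where ppy≡y = involutive M y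

      A≡ : A ≡ ∑ λ x → ∑ λ y → 𝟙 (ordered? x y)
      A≡ = ∑-cong λ x → ∑-involution (involutive M) (λ y → 𝟙 (ordered? x y))

      -- `Q` is the sum of the squared group sizes. Each pair inside a group is in order one way or
      -- the other, and replacing y by p y turns ordered pairs into good pairs.
      Q≤2A : Q ≤ 2 * A
      Q≤2A = begin
        Q                                                        ≤⟨ ∑-mono (λ x → ∑-mono λ y → 𝟙-bound (same? x y) (oriented x y)) ⟩
        ∑ (λ x → ∑ λ y → 𝟙 (ordered? x y) + 𝟙 (ordered? y x))    ≡⟨ ∑-cong (λ x → ∑-+ _ _) ⟩
        ∑ (λ x → ∑ (λ y → 𝟙 (ordered? x y)) + ∑ (λ y → 𝟙 (ordered? y x)))
                                                                 ≡⟨ ∑-+ _ _ ⟩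
        ∑ (λ x → ∑ λ y → 𝟙 (ordered? x y)) + ∑ (λ x → ∑ λ y → 𝟙 (ordered? y x))
                                                                 ≡⟨ cong₂ _+_ (sym A≡) (trans (∑-comm λ x y → 𝟙 (ordered? y x)) (sym A≡)) ⟩
        A + A                                                    ≡⟨ cong (A +_) (+-identityʳ A) ⟨
        2 * A                                                    ∎
        where
        open ≤-Reasoning
        oriented : ∀ x y → Same x y → 1 ≤ 𝟙 (ordered? x y) + 𝟙 (ordered? y x)
        oriented x y s@(x<px , y<py , eq) with ≤ᶠ-total x y
        ... | inj₁ x≤y = ≤-trans (≤-reflexive (sym (𝟙-yes (ordered? x y) (s , x≤y)))) (m≤m+n _ _)
        ... | inj₂ y≤x = ≤-trans (≤-reflexive (sym (𝟙-yes (ordered? y x) ((y<py , x<px , sym eq) , y≤x)))) (m≤n+m _ _)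

      -- Two members of the group of x are in the same group as each other, so the square of one
      -- group size is part of the sum `Q`. This is what keeps all degrees small.
      class² : ∀ x → ∑ (λ y → 𝟙 (same? x y)) ² ≤ Q
      class² x = ≤-trans (≤-reflexive (∑*∑ _ _)) (∑-mono λ y → ∑-mono λ z →
        𝟙-×-≤ (same? x y) (same? x z) (same? y z) λ (_ , y<py , eq) (_ , z<pz , eq′) → y<py , z<pz , trans (sym eq) eq′)

      degree-≤ : ∀ {d} x → d ≤ ∑ (λ y → 𝟙 (same? x y)) → d ² ≤ 2 * A
      degree-≤ x le = ≤-trans (*-mono-≤ le le) (≤-trans (class² x) Q≤2A)

      degˡ : ∀ x → ∑ (λ y → R x y) ² ≤ 2 * A
      degˡ x = degree-≤ x (≤-trans (≤-reflexive (∑-involution (involutive M) (λ y → 𝟙 (ordered? x y))))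
        (∑-mono λ y → 𝟙-bound (ordered? x y) λ (s , _) → ≤-reflexive (sym (𝟙-yes (same? x y) s))))

      degʳ : ∀ y → ∑ (λ x → R x y) ² ≤ 2 * A
      degʳ y = degree-≤ (p y) (∑-mono λ x → 𝟙-bound (ordered? x (p y)) λ ((x<px , py<ppy , eq) , _) →
        ≤-reflexive (sym (𝟙-yes (same? (p y) x) (py<ppy , x<px , sym eq))))

      m²≤2rA : m ² ≤ r * (2 * A)
      m²≤2rA = begin
        m ²                                    ≡⟨ cong _² total ⟨
        ∑ w ²                                  ≤⟨ cauchySchwarz w (λ _ → 1) (λ i → w i ²) (λ i → ≤-reflexive (sym (+-identityʳ (w i ²)))) ⟩
        ∑ {r} (λ _ → 1) * ∑ (λ i → w i ²)      ≡⟨ cong (_* ∑ (λ i → w i ²)) (trans (∑-const r 1) (*-identityʳ r)) ⟩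
        r * ∑ (λ i → w i ²)                    ≤⟨ *-monoʳ-≤ r (≤-trans squares Q≤2A) ⟩
        r * (2 * A)                            ∎
        where
        open ≤-Reasoning
        member? : ∀ i x → Dec (i ≡ idx x × x <ᶠ p x)
        member? i x = (i ≟ᶠ idx x) ×-dec (x <ᶠ? p x)
        w : Fin r → ℕ
        w i = ∑ λ x → 𝟙 (member? i x)
        total : ∑ w ≡ m
        total = trans (∑-comm λ i x → 𝟙 (member? i x)) (∑-cong λ x →
          trans (∑-cong λ i → sym (𝟙-× (i ≟ᶠ idx x) (x <ᶠ? p x) (member? i x) _,_ λ c → c))
          (trans (∑-* _ _) (trans (cong (_* 𝟙 (x <ᶠ? p x)) (∑-𝟙 (idx x))) (*-identityˡ _))))
        -- The factor for i = idx x survives, so that summing over i later contributes exactly 1 for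
        -- each x.
        common : ∀ i x y → 𝟙 (member? i x) * 𝟙 (member? i y) ≤ 𝟙 (i ≟ᶠ idx x) * 𝟙 (same? x y)
        common i x y = ≤-trans
          (𝟙-×-≤ (member? i x) (member? i y) ((i ≟ᶠ idx x) ×-dec same? x y)
            λ (eq , x<px) (eq′ , y<py) → eq , x<px , y<py , trans (sym eq) eq′)
          (≤-reflexive (sym (𝟙-× (i ≟ᶠ idx x) (same? x y) ((i ≟ᶠ idx x) ×-dec same? x y) _,_ λ c → c)))
        squares : ∑ (λ i → w i ²) ≤ Q
        squares = begin
          ∑ (λ i → w i ²)
            ≡⟨ ∑-cong (λ i → ∑*∑ _ _) ⟩
          ∑ (λ i → ∑ λ x → ∑ λ y → 𝟙 (member? i x) * 𝟙 (member? i y))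
            ≤⟨ ∑-mono (λ i → ∑-mono λ x → ∑-mono λ y → common i x y) ⟩
          ∑ (λ i → ∑ λ x → ∑ λ y → 𝟙 (i ≟ᶠ idx x) * 𝟙 (same? x y))
            ≡⟨ ∑-comm (λ i x → ∑ λ y → 𝟙 (i ≟ᶠ idx x) * 𝟙 (same? x y)) ⟩
          ∑ (λ x → ∑ λ i → ∑ λ y → 𝟙 (i ≟ᶠ idx x) * 𝟙 (same? x y))
            ≡⟨ ∑-cong (λ x → sym (∑*∑ _ _)) ⟩
          ∑ (λ x → ∑ (λ i → 𝟙 (i ≟ᶠ idx x)) * ∑ (λ y → 𝟙 (same? x y)))
            ≡⟨ ∑-cong (λ x → trans (cong (_* ∑ (λ y → 𝟙 (same? x y))) (∑-𝟙 (idx x))) (*-identityˡ _)) ⟩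
          Q ∎

  -- Probabilities of a collision and of an erasure, in natural-number parameters.

  module _ (em : ExcludedMiddle 0ℓ) (κ : ℕ) (48≤κ : 48 ≤ κ) {n : ℕ} (x₀ : Fin n) (r t k ρ s : ℕ)
           (r≤ρ² : r ≤ ρ ²) (s≡κρk : s ≡ κ * ρ * k) where

    private
      instance
        n≢0 : NonZero n
        n≢0 = nonZeroIndex x₀
        κ≢0 : NonZero κ
        κ≢0 = >-nonZero (≤-trans (s≤s z≤n) 48≤κ)

      q : ℕ
      q = s + s

    open Tester em x₀ q

    module _ (f : Fin n → ℝ) (values : AtMostDistinctValues r f)
             (far : ∀ g → Sorted g → ∃[ D ] ((∀ x → x ∈ D → ¬ (f x ≃ g x)) × n ≤ k * ∣ D ∣)) where

      -- Collects what the second moment bound consumes. With A the number of good pairs, the last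
      -- component says that the expected number s² A / n² of sampled ones is at least κ² / 8.
      goodRelation : ∃[ R ] ((∀ x y → R x y ² ≡ R x y)
        × (∀ x y → 0 < R x y → x <ᶠ y × f y Defs.< f x)
        × (∀ x → ∑ (λ y → R x y) ² ≤ 2 * ∑ (λ x → ∑ λ y → R x y))
        × (∀ y → ∑ (λ x → R x y) ² ≤ 2 * ∑ (λ x → ∑ λ y → R x y))
        × κ ² * n ² ≤ 8 * (s ² * ∑ (λ x → ∑ λ y → R x y)))
      goodRelation with maximalMatching em f | lowerBound em f
      ... | p , M , residual | c , c≤f =
        R , (λ x y → 𝟙-idem (ordered? x (p y))) , R-violating same-value , degˡ , degʳ , large
        where
        idx : Fin n → Fin r
        idx x = proj₁ (proj₂ values x)
        open GoodPairs M idx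

        same-value : ∀ x y → idx x ≡ idx y → f x Defs.≤ f y
        same-value x y eq = Real.≤-trans (f x) (proj₁ values (idx x)) (f y) (proj₁ (proj₂ (proj₂ values x)))
          (subst (λ i → proj₁ values i Defs.≤ f y) (sym eq) (proj₂ (proj₂ (proj₂ values y))))

        U : Fin n → Bool
        U x = does (p x ≟ᶠ x)
        unmatched : ∀ x → U x ≡ true → p x ≡ x
        unmatched x eq with p x ≟ᶠ x
        ... | yes px≡x = px≡x

        -- A sorted sequence that agrees with f on all unmatched positions: the set where f must
        -- differ from it consists of matched positions only.
        g = repair f U c
        g-sorted : Sorted g
        g-sorted = proj₂ (repair-sorted f U c (λ x _ → c≤f x)
          λ x y Ux Uy → residual x y (unmatched x Ux) (unmatched y Uy))

        D = proj₁ (far g g-sorted)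
        m = ∑ λ x → 𝟙 (x <ᶠ? p x)
        A = ∑ λ x → ∑ λ y → R x y

        matched : ∀ x → x ∈ D → p x ≢ x
        matched x x∈D px≡x = proj₁ (proj₂ (far g g-sorted)) x x∈D
          (subst (f x ≃_) (sym (repair-keep f U c x (dec-true (p x ≟ᶠ x) px≡x))) (Real.≤-refl (f x) , Real.≤-refl (f x)))

        n≤2km : n ≤ k * (2 * m)
        n≤2km = ≤-trans (proj₂ (proj₂ (far g g-sorted))) (*-monoʳ-≤ k (∣matched∣≤2m M D matched))

        large : κ ² * n ² ≤ 8 * (s ² * A)
        large = begin
          κ ² * n ²                              ≤⟨ *-monoʳ-≤ (κ ²) (*-mono-≤ n≤2km n≤2km) ⟩
          κ ² * (k * (2 * m)) ²                  ≡⟨ regroup κ k m ⟩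
          4 * (κ ² * k ²) * m ²                  ≤⟨ *-monoʳ-≤ (4 * (κ ² * k ²)) (≤-trans m²≤2rA (*-monoˡ-≤ (2 * A) r≤ρ²)) ⟩
          4 * (κ ² * k ²) * (ρ ² * (2 * A))      ≡⟨ regroup′ κ k ρ A ⟩
          8 * ((κ * ρ * k) ² * A)                ≡⟨ cong (λ z → 8 * (z ² * A)) s≡κρk ⟨
          8 * (s ² * A)                          ∎
          where
          open ≤-Reasoning
          regroup : ∀ κ k m → κ * κ * (k * (2 * m) * (k * (2 * m))) ≡ 4 * (κ * κ * (k * k)) * (m * m)
          regroup = solve-∀
          regroup′ : ∀ κ k ρ A → 4 * (κ * κ * (k * k)) * (ρ * ρ * (2 * A)) ≡ 8 * (κ * ρ * k * (κ * ρ * k) * A)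
          regroup′ = solve-∀

      module _ (S : Adversary n t) where

        -- A collision occurs with probability at least 5/6. The two halves of the samples are
        -- searched for opposite endpoints, so this is a lower bound obtained from part of the
        -- collisions.
        5T≤6G : 5 * n ^ q ≤ 6 * 𝕊 q (λ v → 𝟙 (em {Collision f S v}))
        5T≤6G = let R , idem , viol , degˡ , degʳ , large = goodRelation in
          *-cancelˡ-≤ (κ ²) (begin
            κ ² * (5 * n ^ q)                        ≡⟨ cong (λ z → κ ² * (5 * z)) (^-distribˡ-+-* n s s) ⟩
            κ ² * (5 * (n ^ s) ²)                    ≡⟨ swap (κ ²) 5 ((n ^ s) ²) ⟩
            5 * (κ ² * (n ^ s) ²)                    ≤⟨ *-monoʳ-≤ 5 (hit R idem degˡ degʳ large) ⟩
            5 * (G R * (κ ² + 8 * κ + 8))            ≡⟨ swap 5 (G R) (κ ² + 8 * κ + 8) ⟩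
            G R * (5 * (κ ² + 8 * κ + 8))            ≤⟨ *-mono-≤ (G≤ R viol) constants ⟩
            C * (6 * κ ²)                            ≡⟨ swap′ C (κ ²) ⟩
            κ ² * (6 * C)                            ∎)
          where
          open ≤-Reasoning
          instance
            κ²≢0 : NonZero (κ ²)
            κ²≢0 = m*n≢0 κ κ
            n²≢0 : NonZero (n ²)
            n²≢0 = m*n≢0 n n
            κ²n²≢0 : NonZero (κ ² * n ²)
            κ²n²≢0 = m*n≢0 (κ ²) (n ²)
          C = 𝕊 q (λ v → 𝟙 (em {Collision f S v}))
          G : (Fin n → Fin n → ℕ) → ℕ
          G R = 𝕊 s λ u → 𝕊 s λ v → 𝟙 (0 <? pairs R u v)
          swap : ∀ a b c → a * (b * c) ≡ b * (a * c)
          swap = solve-∀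
          swap′ : ∀ a b → a * (6 * b) ≡ b * (6 * a)
          swap′ = solve-∀
          hit : ∀ R → (∀ x y → R x y ² ≡ R x y)
            → (∀ x → ∑ (λ y → R x y) ² ≤ 2 * ∑ (λ x → ∑ λ y → R x y))
            → (∀ y → ∑ (λ x → R x y) ² ≤ 2 * ∑ (λ x → ∑ λ y → R x y))
            → κ ² * n ² ≤ 8 * (s ² * ∑ (λ x → ∑ λ y → R x y))
            → κ ² * (n ^ s) ² ≤ G R * (κ ² + 8 * κ + 8)
          hit R idem degˡ degʳ large = manyHits R κ s idem degˡ degʳ large
            where
            A = ∑ λ x → ∑ λ y → R x y
            instance
              -- Positivity of `s` and `A` is read off from `large`, whose left side is positive.
              s²A≢0 : NonZero (s ² * A)
              s²A≢0 = m*n≢0⇒n≢0 8 {{>-nonZero (<-≤-trans (>-nonZero⁻¹ (κ ² * n ²)) large)}}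
              A≢0 : NonZero A
              A≢0 = m*n≢0⇒n≢0 (s ²)
              s²≢0 : NonZero (s ²)
              s²≢0 = m*n≢0⇒m≢0 (s ²)
              s≢0 : NonZero s
              s≢0 = m*n≢0⇒m≢0 s
          collide : ∀ R → (∀ x y → 0 < R x y → x <ᶠ y × f y Defs.< f x) → ∀ u v → 0 < pairs R u v → Collision f S (u ++ v)
          collide R viol u v pos =
            let j , j<s , pos′ = Σᵛ-pos x₀ (λ y → Σᵛ (λ x → R x y) u) v pos
                i , i<s , pos″ = Σᵛ-pos x₀ (λ x → R x (at x₀ v j)) u pos′
                x≡ = at-++ˡ x₀ u v i<s
                y≡ = at-++ʳ x₀ u v j
                x<y , fy<fx = viol _ _ pos″
            in i , s + j , ≤-trans i<s (m≤m+n s s) , +-monoʳ-< s j<s ,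
               subst₂ _<ᶠ_ (sym x≡) (sym y≡) x<y ,
               subst₂ (λ x y → f y Defs.< f x) (sym x≡) (sym y≡) fy<fx
          G≤ : ∀ R → (∀ x y → 0 < R x y → x <ᶠ y × f y Defs.< f x) → G R ≤ C
          G≤ R viol = ≤-trans
            (𝕊-mono s λ u → 𝕊-mono s λ v → 𝟙-bound (0 <? pairs R u v) λ pos →
              ≤-reflexive (sym (𝟙-yes (em {Collision f S (u ++ v)}) (collide R viol u v pos))))
            (≤-reflexive (sym (𝕊-++ s s (λ v → 𝟙 (em {Collision f S v})))))
          -- The origin of 48: 40 κ + 40 is at most 48 κ, and this is absorbed by one κ².
          constants : 5 * (κ ² + 8 * κ + 8) ≤ 6 * κ ²
          constants = begin
            5 * (κ ² + 8 * κ + 8)              ≡⟨ expand κ ⟩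
            5 * κ ² + (40 * κ + 8 * 5)         ≤⟨ +-monoʳ-≤ (5 * κ ²) (+-monoʳ-≤ (40 * κ) (*-monoʳ-≤ 8 (≤-trans (m≤m+n 5 43) 48≤κ))) ⟩
            5 * κ ² + (40 * κ + 8 * κ)         ≡⟨ cong (5 * κ ² +_) (*-distribʳ-+ κ 40 8) ⟨
            5 * κ ² + 48 * κ                   ≤⟨ +-monoʳ-≤ (5 * κ ²) (*-monoˡ-≤ κ 48≤κ) ⟩
            5 * κ ² + κ ²                      ≡⟨ +-comm (5 * κ ²) (κ ²) ⟩
            6 * κ ²                            ∎
            where
            expand : ∀ κ → 5 * (κ * κ + 8 * κ + 8) ≡ 5 * (κ * κ) + (40 * κ + 8 * 5)
            expand = solve-∀

        -- Nothing is erased at the start, so the expected number of hits is at most q² t / n, hence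
        -- at most 1/6.
        6H≤T : 6 * (q * q * t) ≤ n → 6 * 𝕊 q (hits f S (σ₀ f S)) ≤ n ^ q
        6H≤T small = *-cancelˡ-≤ n (begin
          n * (6 * H)                                  ≡⟨ swap n 6 H ⟩
          6 * (n * H)                                  ≤⟨ *-monoʳ-≤ 6 (hits-bound f S q (σ₀ f S)) ⟩
          6 * (n ^ q * (q * (∣ erased f S (σ₀ f S) ∣ + q * t)))
                                                       ≡⟨ cong (λ e → 6 * (n ^ q * (q * (e + q * t)))) (∣⊥∣≡0 n) ⟩
          6 * (n ^ q * (q * (q * t)))                  ≡⟨ regroup (n ^ q) q t ⟩
          6 * (q * q * t) * n ^ q                      ≤⟨ *-monoˡ-≤ (n ^ q) small ⟩
          n * n ^ q                                    ∎)
          where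
          open ≤-Reasoning
          H = 𝕊 q (hits f S (σ₀ f S))
          swap : ∀ a b c → a * (b * c) ≡ b * (a * c)
          swap = solve-∀
          regroup : ∀ N q t → 6 * (N * (q * (q * t))) ≡ 6 * (q * q * t) * N
          regroup = solve-∀

        -- This is 5/6 - 1/6 = 2/3 with denominators cleared.
        rejects-far : 6 * ((s + s) * (s + s) * t) ≤ n → 2 * n ^ (s + s) ≤ 3 * Tester.rejections em x₀ (s + s) f S
        rejects-far small = *-cancelˡ-≤ 2 (+-cancelʳ-≤ T (2 * (2 * T)) (2 * (3 * X)) (begin
          2 * (2 * T) + T      ≡⟨ split T ⟩
          5 * T                ≤⟨ ≤-trans 5T≤6G (*-monoʳ-≤ 6 (collisions-bound f S)) ⟩
          6 * (X + H)          ≡⟨ split′ X H ⟩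
          2 * (3 * X) + 6 * H  ≤⟨ +-monoʳ-≤ (2 * (3 * X)) (6H≤T small) ⟩
          2 * (3 * X) + T      ∎))
          where
          open ≤-Reasoning
          T = n ^ q
          X = rejections f S
          H = 𝕊 q (hits f S (σ₀ f S))
          split : ∀ T → 2 * (2 * T) + T ≡ 5 * T
          split = solve-∀
          split′ : ∀ X H → 6 * (X + H) ≡ 2 * (3 * X) + 6 * H
          split′ = solve-∀

-- Transfer from the real parameters, and the choice of constants.

open import Data.Integer using (+_)
open Defs using (_<_; _≤_; _*_)
open Real using (ι)
open Sampling using (_²)
open Online using (module Tester)
open Violations using (rejects-far)

-- Doubling serves as rounding up, since 1 + ⌊√r⌋ is at most 2 ⌊√r⌋ once r is positive. Unlike 1 +
-- ⌊√r⌋ it vanishes at r = 0, where the bound O(√r/ε) allows no query.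
r≤[2⌊√r⌋]² : ∀ r → r ℕ.≤ (2 ℕ.* ⌊√ r ⌋) ²
r≤[2⌊√r⌋]² r with ⌊√ r ⌋ | n<[1+⌊√n⌋]² r
... | zero  | ℕ.s≤s r≤0 = r≤0
... | suc σ | r<[2+σ]²  = ℕ.≤-trans (ℕ.<⇒≤ r<[2+σ]²) (ℕ.*-mono-≤ le le)
  where
  le : 2 ℕ.+ σ ℕ.≤ 2 ℕ.* suc σ
  le = ℕ.≤-trans (ℕ.+-monoʳ-≤ 2 (ℕ.m≤n*m σ 2)) (ℕ.≤-reflexive (sym (ℕ.*-distribˡ-+ 2 1 σ)))

⌊√r⌋≤√r : ∀ r m → ι ⌊√ r ⌋ ℚ.≤ seq (√ r) m
⌊√r⌋≤√r r m = Real./-mono-≤ σ 1 b M (ℕ.≤-trans (ℕ.≮⇒≥ λ b<σM → ℕ.<-irrefl refl (begin-strict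
  suc b ²               ≤⟨ ℕ.*-mono-≤ b<σM b<σM ⟩
  (σ ℕ.* M) ²           ≡⟨ ℕ.[m*n]*[o*p]≡[m*o]*[n*p] σ M σ M ⟩
  σ ² ℕ.* M ²           ≤⟨ ℕ.*-monoˡ-≤ (M ²) (⌊√n⌋²≤n r) ⟩
  r ℕ.* M ²             <⟨ n<[1+⌊√n⌋]² (r ℕ.* M ²) ⟩
  suc b ²               ∎)) (ℕ.≤-reflexive (sym (ℕ.*-identityʳ b))))
  where
  open ℕ.≤-Reasoning
  M = suc m
  σ = ⌊√ r ⌋
  b = ⌊√ r ℕ.* (M ℕ.* M) ⌋

module _ (n r t k : ℕ) (ε : ℝ) (inverse : Real.ApproximatelyInverse k ε) where

  private
    N = proj₁ inverse
    approx = proj₂ inverse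

  -- If k d < n, then k d + 1 ≤ n ≤ k ε n by integrality; dividing by k leaves the gap 1/k that
  -- witnesses d < ε n.
  far⇒large : ∀ d → ε * fromℕ n ≤ fromℕ d → n ℕ.≤ k ℕ.* d
  far⇒large d εn≤d = ℕ.≮⇒≥ λ kd<n → εn≤d (+ 1 ℚ./ k , ℚ.positive⁻¹ _ {{1/k-pos}} , N , λ m N≤m →
    let e = seq ε m in
    ℚ.*-cancelˡ-≤-pos (ι k) {{ι-pos}} (begin
      ι k ℚ.* (ι d ℚ.+ + 1 ℚ./ k)             ≡⟨ ℚ.*-distribˡ-+ (ι k) (ι d) (+ 1 ℚ./ k) ⟩
      ι k ℚ.* ι d ℚ.+ ι k ℚ.* (+ 1 ℚ./ k)     ≡⟨ cong₂ ℚ._+_ (sym (Real.ι-* k d)) k/k≡1 ⟩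
      ι (k ℕ.* d) ℚ.+ ι 1                     ≡⟨ Real.ι-+ (k ℕ.* d) 1 ⟨
      ι (k ℕ.* d ℕ.+ 1)                       ≤⟨ Real.ι-mono-≤ (subst (ℕ._≤ n) (ℕ.+-comm 1 (k ℕ.* d)) kd<n) ⟩
      ι n                                     ≡⟨ ℚ.*-identityˡ (ι n) ⟨
      1ℚ ℚ.* ι n                              ≤⟨ ℚ.*-monoʳ-≤-nonNeg (ι n) {{Real.ι-nonNeg n}} (proj₁ (proj₂ (approx m N≤m))) ⟩
      ι k ℚ.* e ℚ.* ι n                       ≡⟨ ℚ.*-assoc (ι k) e (ι n) ⟩
      ι k ℚ.* (e ℚ.* ι n)                     ∎))
    where
    open ℚ.≤-Reasoning
    k≢0 : ∀ k → 1ℚ ℚ.≤ ι k ℚ.* seq ε N → ℕ.NonZero k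
    k≢0 (suc k) _  = _
    k≢0 zero    le = ⊥-elim (ℚ.<-irrefl refl (ℚ.<-≤-trans (ℚ.positive⁻¹ 1ℚ)
      (ℚ.≤-trans le (ℚ.≤-reflexive (ℚ.*-zeroˡ (seq ε N))))))
    instance
      k-nonZero : ℕ.NonZero k
      k-nonZero = k≢0 k (proj₁ (proj₂ (approx N ℕ.≤-refl)))
    ι-pos : ℚ.Positive (ι k)
    ι-pos = ℚ.positive (Real.ι-mono-< {0} {k} (ℕ.>-nonZero⁻¹ k))
    k/k≡1 : ι k ℚ.* (+ 1 ℚ./ k) ≡ ι 1
    k/k≡1 = trans (Real./-* k 1 1 k {{_}} {{k-nonZero}} {{ℕ.m*n≢0 1 k}})
      (Real./-cong (k ℕ.* 1) (1 ℕ.* k) 1 1 {{ℕ.m*n≢0 1 k}} (trans (ℕ.*-identityʳ (k ℕ.* 1)) (trans (ℕ.*-comm k 1) (sym (ℕ.*-identityˡ (1 ℕ.* k))))))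
    1/k-pos : ℚ.Positive (+ 1 ℚ./ k)
    1/k-pos = ℚ.positive (ℚ.*-cancelˡ-<-nonNeg (ι k) {{Real.ι-nonNeg k}}
      (subst₂ ℚ._<_ (sym (ℚ.*-zeroʳ (ι k))) (sym k/k≡1) (ℚ.positive⁻¹ 1ℚ)))

  module _ (c : ℕ) (small : fromℕ r * (fromℕ c * fromℕ t) < ε * ε * fromℕ n) where

    private
      δ = proj₁ small
      0<δ = proj₁ (proj₂ small)
      N′ = proj₁ (proj₂ (proj₂ small))
      m = N ℕ.⊔ N′
      e = seq ε m
      0≤e = proj₁ (approx m (ℕ.m≤m⊔n N N′))
      ke≤3 = proj₂ (proj₂ (approx m (ℕ.m≤m⊔n N N′)))
      open ℚ.≤-Reasoning

      x+δ≤ : ι (r ℕ.* (c ℕ.* t)) ℚ.+ δ ℚ.≤ e ℚ.* e ℚ.* ι n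
      x+δ≤ = subst (λ z → z ℚ.+ δ ℚ.≤ e ℚ.* e ℚ.* ι n)
        (trans (cong (ι r ℚ.*_) (sym (Real.ι-* c t))) (sym (Real.ι-* r (c ℕ.* t))))
        (proj₂ (proj₂ (proj₂ small)) m (ℕ.m≤n⊔m N N′))

    -- Provides the position that the tester needs as its default sample.
    n-positive : 0 ℕ.< n
    n-positive = ℕ.≰⇒> λ n≤0 → ℚ.<-irrefl refl (begin-strict
      0ℚ                                 ≤⟨ Real.ι-mono-≤ {0} {r ℕ.* (c ℕ.* t)} ℕ.z≤n ⟩
      ι (r ℕ.* (c ℕ.* t))                <⟨ Real.p<p+δ _ 0<δ ⟩
      ι (r ℕ.* (c ℕ.* t)) ℚ.+ δ          ≤⟨ x+δ≤ ⟩
      e ℚ.* e ℚ.* ι n                    ≡⟨ cong (λ z → e ℚ.* e ℚ.* ι z) (ℕ.n≤0⇒n≡0 n≤0) ⟩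
      e ℚ.* e ℚ.* 0ℚ                     ≡⟨ ℚ.*-zeroʳ (e ℚ.* e) ⟩
      0ℚ                                 ∎)

    -- Multiplying the hypothesis on r by k² replaces ε² by (k ε)², which is at most 9.
    few-erasures : k ² ℕ.* (r ℕ.* (c ℕ.* t)) ℕ.≤ 9 ℕ.* n
    few-erasures = Real.ι-cancel-≤ (begin
      ι (k ² ℕ.* (r ℕ.* (c ℕ.* t)))           ≡⟨ trans (Real.ι-* (k ²) _) (cong (ℚ._* ι (r ℕ.* (c ℕ.* t))) (Real.ι-* k k)) ⟩
      ι k ℚ.* ι k ℚ.* ι (r ℕ.* (c ℕ.* t))     ≤⟨ ℚ.*-monoˡ-≤-nonNeg (ι k ℚ.* ι k) {{ℚ.nonNeg*nonNeg⇒nonNeg (ι k) {{Real.ι-nonNeg k}} (ι k) {{Real.ι-nonNeg k}}}}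
                                                   (ℚ.≤-trans (ℚ.<⇒≤ (Real.p<p+δ _ 0<δ)) x+δ≤) ⟩
      ι k ℚ.* ι k ℚ.* (e ℚ.* e ℚ.* ι n)       ≡⟨ solve 3 (λ k e n → k :* k :* (e :* e :* n) := (k :* e) :* (k :* e) :* n) refl (ι k) e (ι n) ⟩
      y ℚ.* y ℚ.* ι n                         ≤⟨ ℚ.*-monoʳ-≤-nonNeg (ι n) {{Real.ι-nonNeg n}} (ℚ.≤-trans
                                                   (ℚ.*-monoʳ-≤-nonNeg y {{y-nonNeg}} ke≤3) (ℚ.*-monoˡ-≤-nonNeg (ι 3) ke≤3)) ⟩
      ι 9 ℚ.* ι n                             ≡⟨ Real.ι-* 9 n ⟨
      ι (9 ℕ.* n)                             ∎)
      where
      open +-*-Solver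
      y = ι k ℚ.* e
      y-nonNeg : ℚ.NonNegative y
      y-nonNeg = ℚ.nonNeg*nonNeg⇒nonNeg (ι k) {{Real.ι-nonNeg k}} e {{ℚ.nonNegative 0≤e}}

  -- There are 4 κ ⌊√r⌋ k queries and k ε is at most 3, which gives the factor 12 κ.
  fewQueries : ∀ κ → fromℕ (κ ℕ.* (2 ℕ.* ⌊√ r ⌋) ℕ.* k ℕ.+ κ ℕ.* (2 ℕ.* ⌊√ r ⌋) ℕ.* k) * ε ≤ fromℕ (12 ℕ.* κ) * √ r
  fewQueries κ (δ , 0<δ , N′ , more) = ℚ.<-irrefl refl (begin-strict
    ι (12 ℕ.* κ) ℚ.* w                       <⟨ Real.p<p+δ _ 0<δ ⟩
    ι (12 ℕ.* κ) ℚ.* w ℚ.+ δ                 ≤⟨ more m (ℕ.m≤n⊔m N N′) ⟩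
    ι (κ ℕ.* (2 ℕ.* σ) ℕ.* k ℕ.+ κ ℕ.* (2 ℕ.* σ) ℕ.* k) ℚ.* e
                                             ≡⟨ cong (λ z → ι z ℚ.* e) (double κ σ k) ⟩
    ι (4 ℕ.* κ ℕ.* σ ℕ.* k) ℚ.* e            ≡⟨ cong (ℚ._* e) (Real.ι-* (4 ℕ.* κ ℕ.* σ) k) ⟩
    ι (4 ℕ.* κ ℕ.* σ) ℚ.* ι k ℚ.* e          ≡⟨ ℚ.*-assoc (ι (4 ℕ.* κ ℕ.* σ)) (ι k) e ⟩
    ι (4 ℕ.* κ ℕ.* σ) ℚ.* (ι k ℚ.* e)        ≤⟨ ℚ.*-monoˡ-≤-nonNeg (ι (4 ℕ.* κ ℕ.* σ)) {{Real.ι-nonNeg (4 ℕ.* κ ℕ.* σ)}}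
                                                  (proj₂ (proj₂ (approx m (ℕ.m≤m⊔n N N′)))) ⟩
    ι (4 ℕ.* κ ℕ.* σ) ℚ.* ι 3                ≡⟨ Real.ι-* (4 ℕ.* κ ℕ.* σ) 3 ⟨
    ι (4 ℕ.* κ ℕ.* σ ℕ.* 3)                  ≡⟨ cong ι (triple κ σ) ⟩
    ι (12 ℕ.* κ ℕ.* σ)                       ≡⟨ Real.ι-* (12 ℕ.* κ) σ ⟩
    ι (12 ℕ.* κ) ℚ.* ι σ                     ≤⟨ ℚ.*-monoˡ-≤-nonNeg (ι (12 ℕ.* κ)) {{Real.ι-nonNeg (12 ℕ.* κ)}} (⌊√r⌋≤√r r m) ⟩
    ι (12 ℕ.* κ) ℚ.* w                       ∎)
    where
    open ℚ.≤-Reasoning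
    m = N ℕ.⊔ N′
    e = seq ε m
    w = seq (√ r) m
    σ = ⌊√ r ⌋
    double : ∀ κ σ k → κ ℕ.* (2 ℕ.* σ) ℕ.* k ℕ.+ κ ℕ.* (2 ℕ.* σ) ℕ.* k ≡ 4 ℕ.* κ ℕ.* σ ℕ.* k
    double = solve-∀
    triple : ∀ κ σ → 4 ℕ.* κ ℕ.* σ ℕ.* 3 ≡ 12 ℕ.* κ ℕ.* σ
    triple = solve-∀

-- 864 = 9 · 6 · 16, from k ε ≤ 3, an erasure probability of at most 1/6, and
-- q = 4 κ ⌊√r⌋ k.
queryBudget : ∀ κ n r t k → k ² ℕ.* (r ℕ.* (864 ℕ.* κ ² ℕ.* t)) ℕ.≤ 9 ℕ.* n →
  let s = κ ℕ.* (2 ℕ.* ⌊√ r ⌋) ℕ.* k ; q = s ℕ.+ s in 6 ℕ.* (q ℕ.* q ℕ.* t) ℕ.≤ n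
queryBudget κ n r t k small = ℕ.*-cancelˡ-≤ 9 (begin
  9 ℕ.* (6 ℕ.* (q ℕ.* q ℕ.* t))                    ≡⟨ expand κ σ k t ⟩
  864 ℕ.* κ ² ℕ.* k ² ℕ.* t ℕ.* σ ²               ≤⟨ ℕ.*-monoʳ-≤ (864 ℕ.* κ ² ℕ.* k ² ℕ.* t) (⌊√n⌋²≤n r) ⟩
  864 ℕ.* κ ² ℕ.* k ² ℕ.* t ℕ.* r                 ≡⟨ regroup κ k t r ⟩
  k ² ℕ.* (r ℕ.* (864 ℕ.* κ ² ℕ.* t))             ≤⟨ small ⟩
  9 ℕ.* n                                          ∎)
  where
  open ℕ.≤-Reasoning
  σ = ⌊√ r ⌋
  s = κ ℕ.* (2 ℕ.* σ) ℕ.* k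
  q = s ℕ.+ s
  expand : ∀ κ σ k t → 9 ℕ.* (6 ℕ.* ((κ ℕ.* (2 ℕ.* σ) ℕ.* k ℕ.+ κ ℕ.* (2 ℕ.* σ) ℕ.* k) ℕ.* (κ ℕ.* (2 ℕ.* σ) ℕ.* k ℕ.+ κ ℕ.* (2 ℕ.* σ) ℕ.* k) ℕ.* t))
    ≡ 864 ℕ.* (κ ℕ.* κ) ℕ.* (k ℕ.* k) ℕ.* t ℕ.* (σ ℕ.* σ)
  expand = solve-∀
  regroup : ∀ κ k t r → 864 ℕ.* (κ ℕ.* κ) ℕ.* (k ℕ.* k) ℕ.* t ℕ.* r ≡ k ℕ.* k ℕ.* (r ℕ.* (864 ℕ.* (κ ℕ.* κ) ℕ.* t))
  regroup = solve-∀

IsTesterFor : (n r t : ℕ) (ε C : ℝ) → Set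
IsTesterFor n r t ε C = ∃[ q ] Σ[ A ∈ Algorithm n q ]
  ( IsResilientTester t ε (AtMostDistinctValues r) Sorted A
  × HasOneSidedError t (AtMostDistinctValues r) Sorted A
  × Nonadaptive A
  × HasUniformQueries t A
  × HasIndependentQueries t A
  × fromℕ q * ε ≤ C * √ r)

2/3≤1 : + 2 ℚ./ 3 ℚ.≤ 1ℚ
2/3≤1 = Real./-mono-≤ 2 3 1 1 (ℕ.s≤s (ℕ.s≤s ℕ.z≤n))

testerAtScale : ExcludedMiddle 0ℓ → ∀ κ → 48 ℕ.≤ κ → ∀ {n} → Fin n → ∀ r t ε k →
  Real.ApproximatelyInverse k ε → k ² ℕ.* (r ℕ.* (864 ℕ.* κ ² ℕ.* t)) ℕ.≤ 9 ℕ.* n →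
  IsTesterFor n r t ε (fromℕ (12 ℕ.* κ))
testerAtScale em κ 48≤κ {n} x₀ r t ε k approx small = q , tester
  , (λ f values S →
      (λ sorted → ℚ.≤-trans 2/3≤1 (ℚ.≤-reflexive (sym (accepts-sorted f S sorted))))
    , (λ far → Pr[reject]≥⅔ f S (rejects-far em κ 48≤κ x₀ r t k (2 ℕ.* ⌊√ r ⌋) s (r≤[2⌊√r⌋]² r) refl f values
        (λ g sorted → let D , differ , large = far g sorted in
          D , differ , far⇒large n r t k ε approx ∣ D ∣ large) S (queryBudget κ n r t k small))))
  , (λ f values S → accepts-sorted f S)
  , nonadaptive
  , uniform
  , independent
  , fewQueries n r t k ε approx κ
  where
  s = κ ℕ.* (2 ℕ.* ⌊√ r ⌋) ℕ.* k
  q = s ℕ.+ s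
  open Tester em x₀ q

existsTester : ExcludedMiddle 0ℓ → ∀ κ → 48 ℕ.≤ κ → (n r t : ℕ) (ε : ℝ) → fromℕ 0 < ε → ε < fromℕ 1 →
  fromℕ r * (fromℕ (864 ℕ.* κ ²) * fromℕ t) < ε * ε * fromℕ n → IsTesterFor n r t ε (fromℕ (12 ℕ.* κ))
existsTester em κ 48≤κ n r t ε 0<ε ε<1 small = let k , approx = Real.scale ε 0<ε ε<1 in
  testerAtScale em κ 48≤κ (fromℕ< (n-positive n r t k ε approx (864 ℕ.* κ ²) small)) r t ε k approx
    (few-erasures n r t k ε approx (864 ℕ.* κ ²) small)

theorem1p6 : ExcludedMiddle 0ℓ →
    ∃[ c₀ ] ∃[ C ] (fromℕ 0 < c₀ ×
    (∀ (n r t : ℕ) (ε : ℝ) → fromℕ 0 < ε → ε < fromℕ 1 →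
    fromℕ r * (c₀ * fromℕ t) < ε * ε * fromℕ n →
    ∃[ q ] Σ[ A ∈ Algorithm n q ]
    ( IsResilientTester t ε (AtMostDistinctValues r) Sorted A
    × HasOneSidedError t (AtMostDistinctValues r) Sorted A
    × Nonadaptive A
    × HasUniformQueries t A
    × HasIndependentQueries t A
    × fromℕ q * ε ≤ C * √ r)))
-- Both constants are taken at κ = 48: c₀ = 864 κ² and C = 12 κ.
theorem1p6 em = fromℕ (864 ℕ.* 48 ²) , fromℕ (12 ℕ.* 48)
  , (ι (864 ℕ.* 48 ²) , Real.ι-mono-< {0} {864 ℕ.* 48 ²} (ℕ.s≤s ℕ.z≤n) , 0 , λ _ _ → ℚ.≤-reflexive (ℚ.+-identityˡ (ι (864 ℕ.* 48 ²))))
  , existsTester em 48 ℕ.≤-refl
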